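{- Let $t\ge2$, $N=t+2$, and let $\lambda$ be a partition with at most $N$ parts. Suppose exactly two residue classes $r_A<r_B$ modulo $t$ (with $0\le r_A<r_B\le t-1$) contain two elements of $\beta(\lambda)$ and every other class contains exactly one. Then $$d_3=0\iff t\text{ is even},\quad r_B-r_A=\tfrac t2,\quad\text{and}\quad |\lambda^{(r_A)}|=|\lambda^{(r_B)}|+1.$$ In particular, for $t$ odd and any partition $\lambda$ with at most $N$ parts, $s_\lambda(1,\zeta,\dots,\zeta^{t-1},z,z^{ -1})=0$ (identically in $z$, $\zeta=e^{2\pi i/t}$) if and only if some residue class modulo $t$ contains no element of $\beta(\lambda)$.
   Context: For $\lambda=(\lambda_1\ge\dots\ge\lambda_N\ge0)$ let $\beta_j=\lambda_j+N-j$ and $\beta(\lambda)=\{\beta_1>\dots>\beta_N\}$. $\{a_1>a_2\}$ and $\{b_1>b_2\}$ are the elements of $\beta(\lambda)$ in the classes $r_A$ and $r_B$, and $d_3=|a_1+a_2-b_1-b_2|$. The $t$-quotient $(\lambda^{(0)},\dots,\lambda^{(t-1)})$ is computed from this beta set with $N$ elements: if the elements of $\beta(\lambda)$ congruent to $i$ modulo $t$ are $t\tilde a_1+i>\dots>t\tilde a_{n}+i$, then $\lambda^{(i)}=(\tilde a_1-n+1,\tilde a_2-n+2,\dots,\tilde a_n)$. -}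

module Defs where

open import Algebra.Apartness.Bundles using (HeytingField; HeytingCommutativeRing)
open import Algebra.Bundles using (CommutativeRing; Semiring)
import Algebra.Definitions.RawMonoid as RawMonoidDefs
import Algebra.Definitions.RawSemiring as RawSemiringDefs
import Algebra.Properties.CommutativeSemiring.Exp as ExpProps
import Algebra.Properties.Ring as RingProps
import Algebra.Properties.Semiring.Sum as SumProps
import Algebra.Solver.Ring.NaturalCoefficients.Default as Solver
open import Data.Fin.Base as Fin
  using (Fin; zero; suc; toℕ; punchIn; punchOut; inject₁; fromℕ)
import Data.Fin.Properties as Finₚ
open import Data.List.Base as List using (List; []; _∷_; length)
open import Data.Nat.Base as ℕ using (ℕ; zero; suc; NonZero; z≤n; s≤s)
open import Data.Nat.DivMod using (_/_; _%_)
import Data.Nat.Properties as ℕₚ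
open import Data.Product.Base using (_×_; _,_)
open import Data.Vec.Base as Vec using (Vec)
open import Data.Vec.Functional as Vector using (Vector)
open import Function.Base using (_∘_; id)
open import Level using (_⊔_)
open import Relation.Binary.Definitions using (Antitonic₁)
open import Relation.Binary.PropositionalEquality.Core as ≡ using (_≡_; _≢_)
import Relation.Binary.Reasoning.Setoid as SetoidReasoning
open import Relation.Nullary using (yes; no; contradiction)
import Tactic.RingSolver.Core.Expression as Expression

------------------------------------------------------------------------
-- Partitions, beta sets and t-quotients

record Partition (N : ℕ) : Set where
  field
    part       : Vector ℕ N
    decreasing : Antitonic₁ Fin._≤_ ℕ._≤_ part

open Partition public

-- Positions are counted from 0, so that N − j becomes N ∸ suc (toℕ j).
staircase : ∀ N → Vector ℕ N
staircase N j = N ℕ.∸ suc (toℕ j)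

beta : ∀ {N} → Partition N → Vector ℕ N
beta {N} lam j = part lam j ℕ.+ staircase N j

-- The elements of the beta set congruent to r modulo t, in decreasing order.
class : ∀ {N} (t : ℕ) .{{_ : NonZero t}} → Partition N → ℕ → List ℕ
class t lam r = List.filter (λ b → b % t ℕₚ.≟ r) (Vector.toList (beta lam))

-- (a₁ > ⋯ > aₙ) ↦ (a₁ − n + 1, a₂ − n + 2, …, aₙ).  The subtractions are never
-- truncated, as aₖ ≥ n − k for strictly decreasing natural numbers.
removeStaircase : List ℕ → List ℕ
removeStaircase []       = []
removeStaircase (a ∷ as) = (a ℕ.∸ length as) ∷ removeStaircase as

quotient : ∀ {N} (t : ℕ) .{{_ : NonZero t}} → Partition N → ℕ → List ℕ
quotient t lam r = removeStaircase (List.map (_/ t) (class t lam r))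

d₃ : (a₁ a₂ b₁ b₂ : ℕ) → ℕ
d₃ a₁ a₂ b₁ b₂ = ℕ.∣ a₁ ℕ.+ a₂ - b₁ ℕ.+ b₂ ∣

------------------------------------------------------------------------
-- Determinants and Schur polynomials over a commutative ring

module Schur {c ℓ} (R : CommutativeRing c ℓ) where

  open CommutativeRing R hiding (zero)
  open RawMonoidDefs +-rawMonoid using (sum)
  open RawSemiringDefs (Semiring.rawSemiring semiring) using (_^_)
  open Expression using (Expr; Κ; Ι; _⊕_; _⊗_)
  open Expression.Eval rawRing {A = Carrier} id public using (⟦_⟧)

  Matrix : ℕ → Set c
  Matrix n = Fin n → Fin n → Carrier

  sign : ∀ {n} → Fin n → Carrier
  sign zero    = 1#
  sign (suc j) = - sign j

  minor : ∀ {n} → Matrix (suc n) → Fin (suc n) → Matrix n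
  minor M j i k = M (suc i) (punchIn j k)

  -- Laplace expansion along the first row.
  det : ∀ {n} → Matrix n → Carrier
  det {zero}  M = 1#
  det {suc n} M = sum λ j → sign j * (M zero j * det (minor M j))

  -- The alternant det (xᵢ ^ eⱼ).
  alternant : ∀ {N} → Vector ℕ N → Vec Carrier N → Carrier
  alternant e ρ = det λ i j → Vec.lookup ρ i ^ e j

  -- The Schur polynomial of a partition lam with at most N parts is the quotient
  -- of det (xᵢ ^ (lamⱼ + N − j)) by the Vandermonde determinant det (xᵢ ^ (N − j)).
  -- Over an infinite field these properties determine the polynomial function.
  record SchurPolynomial {N} (lam : Partition N) : Set (c ⊔ ℓ) where
    field
      poly        : Expr Carrier N
      bialternant : ∀ ρ → ⟦ poly ⟧ ρ * alternant (staircase N) ρ ≈ alternant (beta lam) ρ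

  open SchurPolynomial public

  ----------------------------------------------------------------------
  -- Row operations on determinants

  open SumProps semiring
    using (sum-cong-≋; sum-remove; sum-replicate-zero; sum-init-last;
           ∑-distrib-+; ∑-comm; *-distribˡ-sum)
  open RingProps ring using (-‿distribˡ-*; -‿distribʳ-*; -‿involutive)
  open Solver commutativeSemiring using (solve; _:+_; _:*_; _:=_; con)
  open SetoidReasoning setoid

  sum-zero : ∀ {n} {f : Vector Carrier n} → (∀ i → f i ≈ 0#) → sum f ≈ 0#
  sum-zero {n} f≈0 = trans (sum-cong-≋ f≈0) (sum-replicate-zero n)

  prod : ∀ {n} → Vector Carrier n → Carrier
  prod = Vector.foldr _*_ 1#

  zero-term : ∀ x y {z} → z ≈ 0# → x * (y * z) ≈ 0#
  zero-term x y z≈0 =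
    trans (*-congˡ (trans (*-congˡ z≈0) (zeroʳ y))) (zeroʳ x)

  neg-* : ∀ x y → - x * - y ≈ x * y
  neg-* x y = trans (sym (-‿distribˡ-* x (- y)))
    (trans (-‿cong (sym (-‿distribʳ-* x y))) (-‿involutive (x * y)))

  sign² : ∀ {n} (j : Fin n) → sign j * sign j ≈ 1#
  sign² zero    = *-identityˡ 1#
  sign² (suc j) = trans (neg-* (sign j) (sign j)) (sign² j)

  det-cong : ∀ {n} {A B : Matrix n} → (∀ i j → A i j ≈ B i j) → det A ≈ det B
  det-cong {zero}  A≈B = refl
  det-cong {suc n} A≈B = sum-cong-≋ λ j → *-congˡ {x = sign j}
    (*-cong (A≈B zero j) (det-cong λ i k → A≈B (suc i) (punchIn j k)))

  det-linear : ∀ {n} (r : Fin n) s {A B C : Matrix n} →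
               (∀ i j → i ≢ r → C i j ≈ A i j) → (∀ i j → i ≢ r → C i j ≈ B i j) →
               (∀ j → C r j ≈ A r j + s * B r j) → det C ≈ det A + s * det B
  det-linear {suc n} r s {A} {B} {C} C≈A C≈B Cr = begin
    det C
      ≈⟨ sum-cong-≋ (term r C≈A C≈B Cr) ⟩
    sum (λ j → tA j + s * tB j)
      ≈⟨ ∑-distrib-+ tA (λ j → s * tB j) ⟩
    det A + sum (λ j → s * tB j)
      ≈⟨ +-congˡ (sym (*-distribˡ-sum s tB)) ⟩
    det A + s * det B ∎
    where
    tA tB : Fin (suc n) → Carrier
    tA j = sign j * (A zero j * det (minor A j))
    tB j = sign j * (B zero j * det (minor B j))
    term : ∀ r → (∀ i j → i ≢ r → C i j ≈ A i j) → (∀ i j → i ≢ r → C i j ≈ B i j) →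
           (∀ j → C r j ≈ A r j + s * B r j) →
           ∀ j → sign j * (C zero j * det (minor C j)) ≈ tA j + s * tB j
    term zero C≈A C≈B Cr j = begin
      sign j * (C zero j * det (minor C j))
        ≈⟨ *-congˡ (*-congʳ (Cr j)) ⟩
      sign j * ((A zero j + s * B zero j) * det (minor C j))
        ≈⟨ solve 5 (λ σ a s b d → σ :* ((a :+ s :* b) :* d)
             := σ :* (a :* d) :+ s :* (σ :* (b :* d))) refl
             (sign j) (A zero j) s (B zero j) (det (minor C j)) ⟩
      sign j * (A zero j * det (minor C j)) + s * (sign j * (B zero j * det (minor C j)))
        ≈⟨ +-cong (*-congˡ (*-congˡ (det-cong λ i k → C≈A (suc i) (punchIn j k) λ ())))
             (*-congˡ (*-congˡ (*-congˡ (det-cong λ i k → C≈B (suc i) (punchIn j k) λ ())))) ⟩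
      tA j + s * tB j ∎
    term (suc r) C≈A C≈B Cr j = begin
      sign j * (C zero j * det (minor C j))
        ≈⟨ *-congˡ (*-congˡ (det-linear r s
             (λ i k i≢r → C≈A (suc i) (punchIn j k) (i≢r ∘ Finₚ.suc-injective))
             (λ i k i≢r → C≈B (suc i) (punchIn j k) (i≢r ∘ Finₚ.suc-injective))
             (λ k → Cr (punchIn j k)))) ⟩
      sign j * (C zero j * (det (minor A j) + s * det (minor B j)))
        ≈⟨ solve 5 (λ σ c a s b → σ :* (c :* (a :+ s :* b))
             := σ :* (c :* a) :+ s :* (σ :* (c :* b))) refl
             (sign j) (C zero j) (det (minor A j)) s (det (minor B j)) ⟩
      sign j * (C zero j * det (minor A j)) + s * (sign j * (C zero j * det (minor B j)))
        ≈⟨ +-cong (*-congˡ (*-congʳ (C≈A zero j λ ())))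
             (*-congˡ (*-congˡ (*-congʳ (C≈B zero j λ ())))) ⟩
      tA j + s * tB j ∎

  det-scale : ∀ {n} (d : Vector Carrier n) (M : Matrix n) →
              det (λ i j → d i * M i j) ≈ prod d * det M
  det-scale {zero}  d M = sym (*-identityˡ 1#)
  det-scale {suc n} d M = begin
    sum (λ j → sign j * (d zero * M zero j * det (λ i k → d (suc i) * minor M j i k)))
      ≈⟨ sum-cong-≋ (λ j → trans (*-congˡ {x = sign j} (*-congˡ {x = d zero * M zero j}
           (det-scale (d ∘ suc) (minor M j))))
           (solve 5 (λ σ d m p e → σ :* (d :* m :* (p :* e)) := d :* p :* (σ :* (m :* e)))
             refl (sign j) (d zero) (M zero j) (prod (d ∘ suc)) (det (minor M j)))) ⟩
    sum (λ j → prod d * (sign j * (M zero j * det (minor M j))))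
      ≈⟨ sym (*-distribˡ-sum (prod d) (λ j → sign j * (M zero j * det (minor M j)))) ⟩
    prod d * det M ∎

  private
    -- For j ≢ j′, skip j j′ enumerates the columns other than j and j′, and ε j j′
    -- is the sign in the expansion along the first two rows.
    skip : ∀ {n} → Fin (2 ℕ.+ n) → Fin (2 ℕ.+ n) → Fin n → Fin (2 ℕ.+ n)
    skip zero    zero     l       = suc (suc l)
    skip zero    (suc j′) l       = suc (punchIn j′ l)
    skip (suc j) zero     l       = suc (punchIn j l)
    skip (suc j) (suc j′) zero    = zero
    skip (suc j) (suc j′) (suc l) = suc (skip j j′ l)

    ε : ∀ {n} → Fin n → Fin n → Carrier
    ε zero    zero     = 0#
    ε zero    (suc j′) = sign j′
    ε (suc j) zero     = - sign j
    ε (suc j) (suc j′) = ε j j′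

    skip-sym : ∀ {n} (j j′ : Fin (2 ℕ.+ n)) l → skip j j′ l ≡ skip j′ j l
    skip-sym zero    zero     l       = ≡.refl
    skip-sym zero    (suc j′) l       = ≡.refl
    skip-sym (suc j) zero     l       = ≡.refl
    skip-sym (suc j) (suc j′) zero    = ≡.refl
    skip-sym (suc j) (suc j′) (suc l) = ≡.cong suc (skip-sym j j′ l)

    skip-punchIn : ∀ {n} (j : Fin (2 ℕ.+ n)) k l →
                   skip j (punchIn j k) l ≡ punchIn j (punchIn k l)
    skip-punchIn zero    k       l       = ≡.refl
    skip-punchIn (suc j) zero    l       = ≡.refl
    skip-punchIn (suc j) (suc k) zero    = ≡.refl
    skip-punchIn (suc j) (suc k) (suc l) = ≡.cong suc (skip-punchIn j k l)

    ε-diag : ∀ {n} (j : Fin n) → ε j j ≈ 0#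
    ε-diag zero    = refl
    ε-diag (suc j) = ε-diag j

    ε-antisym : ∀ {n} (j j′ : Fin n) → ε j j′ + ε j′ j ≈ 0#
    ε-antisym zero    zero     = +-identityˡ 0#
    ε-antisym zero    (suc j′) = -‿inverseʳ (sign j′)
    ε-antisym (suc j) zero     = -‿inverseˡ (sign j)
    ε-antisym (suc j) (suc j′) = ε-antisym j j′

    ε-punchIn : ∀ {n} (j : Fin (suc n)) k → ε j (punchIn j k) ≈ sign j * sign k
    ε-punchIn zero    k       = sym (*-identityˡ (sign k))
    ε-punchIn (suc j) zero    = sym (*-identityʳ (- sign j))
    ε-punchIn (suc j) (suc k) = trans (ε-punchIn j k) (sym (neg-* (sign j) (sign k)))

    -- The (j , j′) term of the expansion along the first two rows.
    term₂ : ∀ {n} → Matrix (2 ℕ.+ n) → Fin (2 ℕ.+ n) → Fin (2 ℕ.+ n) → Carrier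
    term₂ M j j′ = ε j j′ *
      (M zero j * M (suc zero) j′ * det (λ i l → M (suc (suc i)) (skip j j′ l)))

    expand₂ : ∀ {n} (M : Matrix (2 ℕ.+ n)) → det M ≈ sum (λ j → sum (term₂ M j))
    expand₂ M = sum-cong-≋ λ j → begin
      sign j * (M zero j * sum (λ k → sign k * (M (suc zero) (punchIn j k) *
        det (minor (minor M j) k))))
        ≈⟨ sym (*-assoc (sign j) (M zero j) _) ⟩
      sign j * M zero j * sum (λ k → sign k * (M (suc zero) (punchIn j k) *
        det (minor (minor M j) k)))
        ≈⟨ *-distribˡ-sum (sign j * M zero j) (λ k → sign k * (M (suc zero) (punchIn j k) *
             det (minor (minor M j) k))) ⟩
      sum (λ k → sign j * M zero j * (sign k * (M (suc zero) (punchIn j k) *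
        det (minor (minor M j) k))))
        ≈⟨ sum-cong-≋ (λ k → trans
             (solve 5 (λ σ m τ m′ d → σ :* m :* (τ :* (m′ :* d)) := σ :* τ :* (m :* m′ :* d))
               refl (sign j) (M zero j) (sign k) (M (suc zero) (punchIn j k))
               (det (minor (minor M j) k)))
             (*-cong (sym (ε-punchIn j k)) (*-congˡ {x = M zero j * M (suc zero) (punchIn j k)}
               (det-cong λ i l →
                 reflexive (≡.cong (M (suc (suc i))) (≡.sym (skip-punchIn j k l))))))) ⟩
      sum (λ k → term₂ M j (punchIn j k))
        ≈⟨ sym (+-identityˡ _) ⟩
      0# + sum (λ k → term₂ M j (punchIn j k))
        ≈⟨ +-congʳ (sym (trans (*-congʳ (ε-diag j)) (zeroˡ _))) ⟩
      term₂ M j j + sum (λ k → term₂ M j (punchIn j k))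
        ≈⟨ sym (sum-remove {i = j} (term₂ M j)) ⟩
      sum (term₂ M j) ∎

    sum-antisym : ∀ {n} (f : Fin n → Fin n → Carrier) → (∀ j → f j j ≈ 0#) →
                  (∀ j k → f j k + f k j ≈ 0#) → sum (λ j → sum (f j)) ≈ 0#
    sum-antisym {zero}  f diag anti = refl
    sum-antisym {suc n} f diag anti = begin
      (f zero zero + sum (λ k → f zero (suc k))) +
        sum (λ j → f (suc j) zero + sum (λ k → f (suc j) (suc k)))
        ≈⟨ +-cong (trans (+-congʳ (diag zero)) (+-identityˡ _))
             (∑-distrib-+ (λ j → f (suc j) zero) (λ j → sum (λ k → f (suc j) (suc k)))) ⟩
      sum (λ k → f zero (suc k)) +
        (sum (λ j → f (suc j) zero) + sum (λ j → sum (λ k → f (suc j) (suc k))))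
        ≈⟨ sym (+-assoc _ _ _) ⟩
      (sum (λ k → f zero (suc k)) + sum (λ j → f (suc j) zero)) +
        sum (λ j → sum (λ k → f (suc j) (suc k)))
        ≈⟨ +-cong (sym (∑-distrib-+ (λ k → f zero (suc k)) (λ j → f (suc j) zero)))
             (sum-antisym (λ j k → f (suc j) (suc k)) (diag ∘ suc) (λ j k → anti (suc j) (suc k))) ⟩
      sum (λ k → f zero (suc k) + f (suc k) zero) + 0#
        ≈⟨ +-identityʳ _ ⟩
      sum (λ k → f zero (suc k) + f (suc k) zero)
        ≈⟨ sum-zero (λ k → anti zero (suc k)) ⟩
      0# ∎

    swap₀₁ : ∀ {n} → Matrix (2 ℕ.+ n) → Matrix (2 ℕ.+ n)
    swap₀₁ M zero          = M (suc zero)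
    swap₀₁ M (suc zero)    = M zero
    swap₀₁ M (suc (suc i)) = M (suc (suc i))

    term₂-swap : ∀ {n} (M : Matrix (2 ℕ.+ n)) j k → term₂ M j k + term₂ (swap₀₁ M) k j ≈ 0#
    term₂-swap M j k = begin
      term₂ M j k + term₂ (swap₀₁ M) k j
        ≈⟨ +-congˡ (*-congˡ (*-cong (*-comm (M (suc zero) k) (M zero j)) (det-cong λ i l →
             reflexive (≡.cong (M (suc (suc i))) (skip-sym k j l))))) ⟩
      ε j k * t + ε k j * t
        ≈⟨ sym (distribʳ t (ε j k) (ε k j)) ⟩
      (ε j k + ε k j) * t
        ≈⟨ *-congʳ (ε-antisym j k) ⟩
      0# * t
        ≈⟨ zeroˡ t ⟩
      0# ∎
      where
      t = M zero j * M (suc zero) k * det (λ i l → M (suc (suc i)) (skip j k l))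

    det-swap₀₁ : ∀ {n} (M : Matrix (2 ℕ.+ n)) → det M + det (swap₀₁ M) ≈ 0#
    det-swap₀₁ M = begin
      det M + det (swap₀₁ M)
        ≈⟨ +-cong (expand₂ M) (trans (expand₂ (swap₀₁ M)) (∑-comm (term₂ (swap₀₁ M)))) ⟩
      sum (λ j → sum (term₂ M j)) + sum (λ j → sum (λ k → term₂ (swap₀₁ M) k j))
        ≈⟨ sym (∑-distrib-+ (λ j → sum (term₂ M j)) (λ j → sum (λ k → term₂ (swap₀₁ M) k j))) ⟩
      sum (λ j → sum (term₂ M j) + sum (λ k → term₂ (swap₀₁ M) k j))
        ≈⟨ sum-zero (λ j → trans (sym (∑-distrib-+ (term₂ M j) (λ k → term₂ (swap₀₁ M) k j)))
             (sum-zero (term₂-swap M j))) ⟩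
      0# ∎

  det-alternating : ∀ {n} (M : Matrix n) a b → a Fin.< b → (∀ j → M a j ≈ M b j) → det M ≈ 0#
  det-alternating {suc n} M (suc a) (suc b) (s≤s a<b) Ma≈Mb = sum-zero λ j →
    zero-term (sign j) (M zero j)
      (det-alternating (minor M j) a b a<b (Ma≈Mb ∘ punchIn j))
  det-alternating {suc (suc n)} M zero (suc zero) _ M₀≈M₁ = trans (expand₂ M)
    (sum-antisym (term₂ M) (λ j → trans (*-congʳ (ε-diag j)) (zeroˡ _))
      λ j k → trans (+-congˡ (*-congˡ (*-congʳ (*-cong (M₀≈M₁ k) (sym (M₀≈M₁ j))))))
        (term₂-swap M j k))
  det-alternating {suc (suc n)} M zero (suc (suc b)) _ M₀≈Mb = begin
    det M
      ≈⟨ sym (+-identityʳ _) ⟩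
    det M + 0#
      ≈⟨ +-congˡ (sym (sum-zero λ j → zero-term (sign j) (M (suc zero) j)
           (det-alternating (minor (swap₀₁ M) j) zero (suc b) (s≤s z≤n) (M₀≈Mb ∘ punchIn j)))) ⟩
    det M + det (swap₀₁ M)
      ≈⟨ det-swap₀₁ M ⟩
    0# ∎

  addFirst : ∀ {n} → Vector Carrier n → Matrix (suc n) → Matrix (suc n)
  addFirst v M zero    j = M zero j
  addFirst v M (suc i) j = M (suc i) j + v i * M zero j

  clear : ∀ {n} → Fin n → Vector Carrier n → Vector Carrier n
  clear r v i with i Finₚ.≟ r
  ... | yes _ = 0#
  ... | no  _ = v i

  clear-same : ∀ {n} (r : Fin n) v → clear r v r ≈ 0#
  clear-same r v with r Finₚ.≟ r
  ... | yes _   = refl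
  ... | no  r≢r = contradiction ≡.refl r≢r

  clear-other : ∀ {n} (r : Fin n) v {i} → i ≢ r → clear r v i ≈ v i
  clear-other r v {i} i≢r with i Finₚ.≟ r
  ... | yes i≡r = contradiction i≡r i≢r
  ... | no  _   = refl

  addFirst-step : ∀ {n} (r : Fin n) (v : Vector Carrier n) (M : Matrix (suc n)) →
                  det (addFirst v M) ≈ det (addFirst (clear r v) M)
  addFirst-step {n} r v M = begin
    det (addFirst v M)
      ≈⟨ det-linear (suc r) (v r) off₁ off₂ row ⟩
    det A + v r * det B
      ≈⟨ +-congˡ (trans (*-congˡ (det-alternating B zero (suc r) (s≤s z≤n)
           λ j → sym (B-row j))) (zeroʳ _)) ⟩
    det A + 0#
      ≈⟨ +-identityʳ _ ⟩
    det A ∎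
    where
    A B : Matrix (suc n)
    A = addFirst (clear r v) M
    B zero    j = M zero j
    B (suc i) j with i Finₚ.≟ r
    ... | yes _ = M zero j
    ... | no  _ = addFirst v M (suc i) j
    B-row : ∀ j → B (suc r) j ≈ M zero j
    B-row j with r Finₚ.≟ r
    ... | yes _   = refl
    ... | no  r≢r = contradiction ≡.refl r≢r
    off₁ : ∀ i j → i ≢ suc r → addFirst v M i j ≈ A i j
    off₁ zero    j _   = refl
    off₁ (suc i) j i≢r = +-congˡ (*-congʳ (sym (clear-other r v (i≢r ∘ ≡.cong suc))))
    off₂ : ∀ i j → i ≢ suc r → addFirst v M i j ≈ B i j
    off₂ zero    j _ = refl
    off₂ (suc i) j i≢r with i Finₚ.≟ r
    ... | yes i≡r = contradiction (≡.cong suc i≡r) i≢r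
    ... | no  _   = refl
    row : ∀ j → addFirst v M (suc r) j ≈ A (suc r) j + v r * B (suc r) j
    row j = begin
      M (suc r) j + v r * M zero j
        ≈⟨ +-cong (sym (trans (+-congˡ (trans (*-congʳ (clear-same r v)) (zeroˡ _)))
             (+-identityʳ _))) (*-congˡ (sym (B-row j))) ⟩
      A (suc r) j + v r * B (suc r) j ∎

  det-addFirst′ : ∀ {n} k (v : Vector Carrier n) (M : Matrix (suc n)) →
                  (∀ i → k ℕ.≤ toℕ i → v i ≈ 0#) → det (addFirst v M) ≈ det M
  det-addFirst′ zero v M v≈0 = det-cong {A = addFirst v M} {B = M} λ where
    zero    j → refl
    (suc i) j → trans (+-congˡ (trans (*-congʳ (v≈0 i z≤n)) (zeroˡ _))) (+-identityʳ _)
  det-addFirst′ {n} (suc k) v M v≈0 with k ℕₚ.<? n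
  ... | no  k≮n = det-addFirst′ k v M λ i k≤i →
    contradiction (ℕₚ.≤-<-trans k≤i (Finₚ.toℕ<n i)) k≮n
  ... | yes k<n = trans (addFirst-step r v M) (det-addFirst′ k (clear r v) M zeros)
    where
    r : Fin n
    r = Fin.fromℕ< k<n
    zeros : ∀ i → k ℕ.≤ toℕ i → clear r v i ≈ 0#
    zeros i k≤i with i Finₚ.≟ r
    ... | yes _   = refl
    ... | no  i≢r = v≈0 i (ℕₚ.≤∧≢⇒< k≤i λ k≡i →
      i≢r (Finₚ.toℕ-injective (≡.trans (≡.sym k≡i) (≡.sym (Finₚ.toℕ-fromℕ< k<n)))))

  det-addFirst : ∀ {n} (v : Vector Carrier n) (M : Matrix (suc n)) →
                 det (addFirst v M) ≈ det M
  det-addFirst {n} v M = det-addFirst′ n v M λ i n≤i →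
    contradiction (ℕₚ.≤-<-trans n≤i (Finₚ.toℕ<n i)) (ℕₚ.<-irrefl ≡.refl)

  ----------------------------------------------------------------------
  -- Existence of Schur polynomials: Newton interpolation, i.e. iterated divided
  -- differences, divides an alternant by ∏ᵢ<ⱼ (xⱼ − xᵢ).

  module _ {N : ℕ} where

    -- For p nonempty, the complete homogeneous polynomial of degree m + 1 − length p
    -- in the variables listed in p (0 in negative degree).
    homog : ℕ → List (Fin N) → Expr Carrier N
    homog m       []          = Κ 0#
    homog zero    (y ∷ [])    = Κ 1#
    homog zero    (y ∷ x ∷ p) = Κ 0#
    homog (suc m) (y ∷ p)     = (Ι y ⊗ homog m (y ∷ p)) ⊕ homog m p

    sumᴱ : ∀ {n} → Vector (Expr Carrier N) n → Expr Carrier N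
    sumᴱ = Vector.foldr _⊕_ (Κ 0#)

    newton : ∀ {n} → List (Fin N) → Vector (Fin N) n → Vector ℕ n → Expr Carrier N
    newton {zero}  p x e = Κ 1#
    newton {suc n} p x e = sumᴱ λ j → Κ (sign j) ⊗
      (homog (e j) (x zero ∷ p) ⊗ newton (x zero ∷ p) (x ∘ suc) (e ∘ punchIn j))

    module _ (ρ : Vec Carrier N) where

      X : Fin N → Carrier
      X = Vec.lookup ρ

      vandermonde : ∀ {n} → Vector (Fin N) n → Carrier
      vandermonde {zero}  x = 1#
      vandermonde {suc n} x =
        prod (λ i → X (x (suc i)) - X (x zero)) * vandermonde (x ∘ suc)

      ⟦sumᴱ⟧ : ∀ {n} (f : Vector (Expr Carrier N) n) → ⟦ sumᴱ f ⟧ ρ ≈ sum (λ j → ⟦ f j ⟧ ρ)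
      ⟦sumᴱ⟧ {zero}  f = refl
      ⟦sumᴱ⟧ {suc n} f = +-congˡ (⟦sumᴱ⟧ (f ∘ suc))

      cancel : ∀ y x → (y - x) + x ≈ y
      cancel y x = trans (+-assoc y (- x) x) (trans (+-congˡ (-‿inverseˡ x)) (+-identityʳ y))

      homog-difference : ∀ m y x p → ⟦ homog m (y ∷ p) ⟧ ρ ≈
        (X y - X x) * ⟦ homog m (y ∷ x ∷ p) ⟧ ρ + 1# * ⟦ homog m (x ∷ p) ⟧ ρ
      homog-difference zero y x []      = sym (trans (+-cong (zeroʳ _) (*-identityˡ 1#)) (+-identityˡ 1#))
      homog-difference zero y x (_ ∷ p) = sym (trans (+-cong (zeroʳ _) (*-identityˡ 0#)) (+-identityˡ 0#))
      homog-difference (suc m) y x p = begin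
        X y * A + B
          ≈⟨ +-congʳ (*-congˡ (homog-difference m y x p)) ⟩
        X y * (d * C + 1# * D) + B
          ≈⟨ solve 5 (λ y d C D B → y :* (d :* C :+ con 1 :* D) :+ B
               := y :* D :+ (d :* (y :* C) :+ B)) refl (X y) d C D B ⟩
        X y * D + (d * (X y * C) + B)
          ≈⟨ +-congʳ (*-congʳ (sym (cancel (X y) (X x)))) ⟩
        (d + X x) * D + (d * (X y * C) + B)
          ≈⟨ solve 6 (λ y d C D B x → (d :+ x) :* D :+ (d :* (y :* C) :+ B)
               := d :* (y :* C :+ D) :+ con 1 :* (x :* D :+ B)) refl (X y) d C D B (X x) ⟩
        d * (X y * C + D) + 1# * (X x * D + B) ∎
        where
        d = X y - X x
        A = ⟦ homog m (y ∷ p) ⟧ ρ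
        B = ⟦ homog m p ⟧ ρ
        C = ⟦ homog m (y ∷ x ∷ p) ⟧ ρ
        D = ⟦ homog m (x ∷ p) ⟧ ρ

      homog-zero : ∀ m p → suc m ℕ.< length p → ⟦ homog m p ⟧ ρ ≈ 0#
      homog-zero zero    (y ∷ [])    (s≤s ())
      homog-zero zero    (y ∷ x ∷ p) _ = refl
      homog-zero (suc m) (y ∷ p) (s≤s m<p) = trans (+-cong
        (trans (*-congˡ (homog-zero m (y ∷ p) (ℕₚ.m<n⇒m<1+n m<p))) (zeroʳ (X y)))
        (homog-zero m p m<p)) (+-identityˡ 0#)

      homog-one : ∀ m p → suc m ≡ length p → ⟦ homog m p ⟧ ρ ≈ 1#
      homog-one zero    (y ∷ [])    _  = refl
      homog-one (suc m) (y ∷ p)     eq = trans (+-cong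
        (trans (*-congˡ (homog-zero m (y ∷ p) (ℕₚ.≤-reflexive eq))) (zeroʳ (X y)))
        (homog-one m p (ℕₚ.suc-injective eq))) (+-identityˡ 1#)

      homog-single : ∀ m y → ⟦ homog m (y ∷ []) ⟧ ρ ≈ X y ^ m
      homog-single zero    y = refl
      homog-single (suc m) y = trans (+-identityʳ _) (*-congˡ (homog-single m y))

      newton-det : ∀ {n} p (x : Vector (Fin N) n) e →
        det (λ i j → ⟦ homog (e j) (x i ∷ p) ⟧ ρ) ≈ vandermonde x * ⟦ newton p x e ⟧ ρ
      newton-det {zero}  p x e = sym (*-identityˡ 1#)
      newton-det {suc n} p x e = begin
        det (λ i j → ⟦ homog (e j) (x i ∷ p) ⟧ ρ)
          ≈⟨ det-cong {A = λ i j → ⟦ homog (e j) (x i ∷ p) ⟧ ρ} {B = addFirst (λ _ → 1#) M} (λ where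
               zero    j → refl
               (suc i) j → homog-difference (e j) (x (suc i)) (x zero) p) ⟩
        det (addFirst (λ _ → 1#) M)
          ≈⟨ det-addFirst (λ _ → 1#) M ⟩
        det M
          ≈⟨ sum-cong-≋ (λ j → trans (*-congˡ {x = sign j} (*-congˡ {x = M zero j}
               (trans (det-scale d (Q j)) (*-congˡ {x = prod d}
                 (newton-det (x zero ∷ p) (x ∘ suc) (e ∘ punchIn j))))))
               (solve 5 (λ σ m d v s → σ :* (m :* (d :* (v :* s))) := d :* v :* (σ :* (m :* s)))
                 refl (sign j) (M zero j) (prod d) (vandermonde (x ∘ suc)) (S j))) ⟩
        sum (λ j → vandermonde x * (sign j * (M zero j * S j)))
          ≈⟨ sym (*-distribˡ-sum (vandermonde x) (λ j → sign j * (M zero j * S j))) ⟩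
        vandermonde x * sum (λ j → sign j * (M zero j * S j))
          ≈⟨ *-congˡ (sym (⟦sumᴱ⟧ (λ j → Κ (sign j) ⊗
               (homog (e j) (x zero ∷ p) ⊗ newton (x zero ∷ p) (x ∘ suc) (e ∘ punchIn j))))) ⟩
        vandermonde x * ⟦ newton p x e ⟧ ρ ∎
        where
        d : Vector Carrier n
        d i = X (x (suc i)) - X (x zero)
        Q : Fin (suc n) → Matrix n
        Q j i k = ⟦ homog (e (punchIn j k)) (x (suc i) ∷ x zero ∷ p) ⟧ ρ
        M : Matrix (suc n)
        M zero    j = ⟦ homog (e j) (x zero ∷ p) ⟧ ρ
        M (suc i) j = d i * ⟦ homog (e j) (x (suc i) ∷ x zero ∷ p) ⟧ ρ
        S : Fin (suc n) → Carrier
        S j = ⟦ newton (x zero ∷ p) (x ∘ suc) (e ∘ punchIn j) ⟧ ρ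

      newton-zero : ∀ {n} p (x : Vector (Fin N) n) e j → e j ℕ.< length p →
                    ⟦ newton p x e ⟧ ρ ≈ 0#
      newton-zero {suc n} p x e j₀ e<p = trans (⟦sumᴱ⟧ term) (sum-zero λ j → vanish j (j Finₚ.≟ j₀))
        where
        term : Vector (Expr Carrier N) (suc n)
        term j = Κ (sign j) ⊗
          (homog (e j) (x zero ∷ p) ⊗ newton (x zero ∷ p) (x ∘ suc) (e ∘ punchIn j))
        vanish : ∀ j → _ → ⟦ term j ⟧ ρ ≈ 0#
        vanish j (yes ≡.refl) = trans (*-congˡ (trans (*-congʳ
          (homog-zero (e j) (x zero ∷ p) (s≤s e<p))) (zeroˡ _))) (zeroʳ _)
        vanish j (no j≢j₀) = zero-term (sign j) (⟦ homog (e j) (x zero ∷ p) ⟧ ρ)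
          (newton-zero (x zero ∷ p) (x ∘ suc) (e ∘ punchIn j) (punchOut j≢j₀)
            (≡.subst (λ k → e k ℕ.< suc (length p)) (≡.sym (Finₚ.punchIn-punchOut j≢j₀))
              (ℕₚ.m<n⇒m<1+n e<p)))

      punchIn-last : ∀ {n} (k : Fin n) → punchIn (fromℕ n) k ≡ inject₁ k
      punchIn-last zero    = ≡.refl
      punchIn-last (suc k) = ≡.cong suc (punchIn-last k)

      newton-staircase : ∀ {n} p (x : Vector (Fin N) n) e →
        (∀ j → e j ≡ staircase n j ℕ.+ length p) →
        ⟦ newton p x e ⟧ ρ * ⟦ newton p x e ⟧ ρ ≈ 1#
      newton-staircase {zero}  p x e e≡ = *-identityˡ 1#
      newton-staircase {suc n} p x e e≡ = begin
        ⟦ newton p x e ⟧ ρ * ⟦ newton p x e ⟧ ρ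
          ≈⟨ *-cong lastTerm lastTerm ⟩
        (σ * (1# * s)) * (σ * (1# * s))
          ≈⟨ solve 2 (λ σ s → (σ :* (con 1 :* s)) :* (σ :* (con 1 :* s)) := (σ :* σ) :* (s :* s))
               refl σ s ⟩
        (σ * σ) * (s * s)
          ≈⟨ *-cong (sign² (fromℕ n)) (newton-staircase (x zero ∷ p) (x ∘ suc)
               (e ∘ punchIn (fromℕ n)) e′≡) ⟩
        1# * 1#
          ≈⟨ *-identityˡ 1# ⟩
        1# ∎
        where
        term : Vector (Expr Carrier N) (suc n)
        term j = Κ (sign j) ⊗
          (homog (e j) (x zero ∷ p) ⊗ newton (x zero ∷ p) (x ∘ suc) (e ∘ punchIn j))
        σ s : Carrier
        σ = sign (fromℕ n)
        s = ⟦ newton (x zero ∷ p) (x ∘ suc) (e ∘ punchIn (fromℕ n)) ⟧ ρ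
        e-last : e (fromℕ n) ≡ length p
        e-last = ≡.trans (e≡ (fromℕ n)) (≡.cong (ℕ._+ length p)
          (≡.trans (≡.cong (n ℕ.∸_) (Finₚ.toℕ-fromℕ n)) (ℕₚ.n∸n≡0 n)))
        e′≡ : ∀ j → e (punchIn (fromℕ n) j) ≡ staircase n j ℕ.+ suc (length p)
        e′≡ j = ≡.trans (e≡ (punchIn (fromℕ n) j)) (≡.trans
          (≡.cong (λ k → n ℕ.∸ k ℕ.+ length p)
            (≡.trans (≡.cong toℕ (punchIn-last j)) (Finₚ.toℕ-inject₁ j)))
          (≡.trans (≡.cong (ℕ._+ length p) (ℕₚ.+-∸-assoc 1 (Finₚ.toℕ<n j)))
            (≡.sym (ℕₚ.+-suc (staircase n j) (length p)))))
        vanish : ∀ j → ⟦ term (inject₁ j) ⟧ ρ ≈ 0#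
        vanish j = zero-term (sign (inject₁ j)) (⟦ homog (e (inject₁ j)) (x zero ∷ p) ⟧ ρ)
          (newton-zero (x zero ∷ p) (x ∘ suc) (e ∘ punchIn (inject₁ j)) (punchOut j≢n)
            (≡.subst (λ k → e k ℕ.< suc (length p)) (≡.sym (Finₚ.punchIn-punchOut j≢n))
              (s≤s (ℕₚ.≤-reflexive e-last))))
          where
          j≢n : inject₁ j ≢ fromℕ n
          j≢n eq = Finₚ.fromℕ≢inject₁ (≡.sym eq)
        lastTerm : ⟦ newton p x e ⟧ ρ ≈ σ * (1# * s)
        lastTerm = begin
          ⟦ newton p x e ⟧ ρ
            ≈⟨ trans (⟦sumᴱ⟧ term) (sum-init-last (λ j → ⟦ term j ⟧ ρ)) ⟩
          sum (λ j → ⟦ term (inject₁ j) ⟧ ρ) + ⟦ term (fromℕ n) ⟧ ρ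
            ≈⟨ trans (+-congʳ (sum-zero vanish)) (+-identityˡ _) ⟩
          σ * (⟦ homog (e (fromℕ n)) (x zero ∷ p) ⟧ ρ * s)
            ≈⟨ *-congˡ (*-congʳ (homog-one (e (fromℕ n)) (x zero ∷ p) (≡.cong suc e-last))) ⟩
          σ * (1# * s) ∎

      newton-alternant : ∀ e → alternant e ρ ≈ vandermonde id * ⟦ newton [] id e ⟧ ρ
      newton-alternant e = trans
        (det-cong λ i j → sym (homog-single (e j) i)) (newton-det [] id e)

  schur : ∀ {N} (lam : Partition N) → SchurPolynomial lam
  schur {N} lam = record
    { poly        = newton [] id (beta lam) ⊗ newton [] id (staircase N)
    ; bialternant = λ ρ →
        let s = ⟦ newton [] id (beta lam) ⟧ ρ
            u = ⟦ newton [] id (staircase N) ⟧ ρ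
            v = vandermonde ρ id
        in begin
        s * u * alternant (staircase N) ρ
          ≈⟨ *-congˡ (newton-alternant ρ (staircase N)) ⟩
        s * u * (v * u)
          ≈⟨ solve 3 (λ s u v → s :* u :* (v :* u) := v :* s :* (u :* u)) refl s u v ⟩
        v * s * (u * u)
          ≈⟨ *-congˡ (newton-staircase ρ [] id (staircase N) λ j → ≡.sym (ℕₚ.+-identityʳ _)) ⟩
        v * s * 1#
          ≈⟨ trans (*-identityʳ _) (sym (newton-alternant ρ (beta lam))) ⟩
        alternant (beta lam) ρ ∎
    }

------------------------------------------------------------------------
-- Specialisation at roots of unity
--
-- K stands for ℂ, read with z # w as z ≠ w, and ζ for e^(2πi/t): over any field of
-- characteristic zero only the primitivity of the root of unity ζ is used.

module _ {c ℓ₁ ℓ₂} (K : HeytingField c ℓ₁ ℓ₂) where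

  open HeytingField K hiding (zero)

  private
    ring : CommutativeRing c ℓ₁
    ring = HeytingCommutativeRing.commutativeRing heytingCommutativeRing

  open RawMonoidDefs (CommutativeRing.+-rawMonoid ring) using () renaming (_×_ to _·_)
  open RawSemiringDefs (Semiring.rawSemiring (CommutativeRing.semiring ring)) using (_^_)

  CharacteristicZero : Set ℓ₂
  CharacteristicZero = ∀ n → (suc n · 1#) # 0#

  PrimitiveRoot : ℕ → Carrier → Set (ℓ₁ ⊔ ℓ₂)
  PrimitiveRoot t ζ = (ζ ^ t ≈ 1#) × (∀ k → 0 ℕ.< k → k ℕ.< t → (ζ ^ k) # 1#)

  -- (1 , ζ , … , ζ ^ (t − 1) , z , w)
  point : ∀ t → (ζ z w : Carrier) → Vec Carrier (t ℕ.+ 2)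
  point t ζ z w =
    Vec._++_ (Vec.tabulate {n = t} λ i → ζ ^ toℕ i) (z Vec.∷ w Vec.∷ Vec.[])

  schurValue : ∀ {N} → Partition N → Vec Carrier N → Carrier
  schurValue lam = ⟦ poly (schur lam) ⟧
    where open Schur ring

  -- Vanishing for all invertible (that is, nonzero) z, with w = z⁻¹.  As K is
  -- infinite, this is vanishing as a Laurent polynomial in z.
  SchurVanishes : ∀ {t} → Partition (t ℕ.+ 2) → Carrier → Set (c ⊔ ℓ₁)
  SchurVanishes {t} lam ζ = ∀ z w → z * w ≈ 1# → schurValue lam (point t ζ z w) ≈ 0#

{-# OPTIONS --safe #-}

-- Modulo t, a₁ + a₂ = b₁ + b₂ forces 2 (r_B − r_A) ≡ 0 with 0 < 2 (r_B − r_A) < 2t, so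
-- t = 2 (r_B − r_A), and comparing quotients gives the condition on the sizes.
--
-- For the vanishing, let Lᵣ be the functional f ↦ ∑ᵢ ζ⁻ⁱʳ f(ζⁱ): it takes x^e to t if
-- e ≡ r modulo t and to 0 otherwise.
--
-- If the class r is empty, then Lᵣ kills every x^βⱼ.  The Schur polynomial is, up to a
-- unit, the determinant of the divided differences of the x^βⱼ along 1, ζ, …, ζ^(t−1), z, w.
-- In terms of these Lᵣ is a nontrivial relation between the rows, whatever z and w are, so
-- the points where the Vandermonde determinant vanishes need no separate treatment.
--
-- If no class is empty, choose a representative in each class; two columns u and v remain.
-- We evaluate at z = 2, w = 1/2 and show that the row space of the alternant contains a
-- multiple of every unit vector.  Write û for the exponent representing the class of u.
-- Subtracting combinations of the Lᵣ from the rows of z and w leaves rows supported on u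
-- and v, with entries z^u − z^û and w^u − w^û = − w^(u + û) (z^u − z^û).  They are
-- independent as soon as u + û ≠ v + v̂, which holds for t odd.
module Submission where

open import Defs
open import Algebra.Apartness.Bundles using (HeytingField; HeytingCommutativeRing)
import Algebra.Apartness.Properties.HeytingCommutativeRing as HeytingProps
open import Algebra.Bundles using (CommutativeRing)
import Algebra.Definitions.RawMonoid as RawMonoidDefs
import Algebra.Properties.AbelianGroup as AbelianGroupProps
import Algebra.Properties.CommutativeSemiring.Exp as CommExpProps
import Algebra.Properties.Ring as RingProps
import Algebra.Properties.Semiring.Exp as ExpProps
import Algebra.Properties.Semiring.Mult as MultProps
import Algebra.Properties.Semiring.Sum as SumProps
import Algebra.Solver.Ring.NaturalCoefficients.Default as Solver
open import Data.Fin.Base as Fin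
  using (Fin; zero; suc; toℕ; fromℕ<; punchIn; punchOut; _↑ˡ_; _↑ʳ_)
import Data.Fin.Properties as Finₚ
open import Data.List.Base as List using (List; []; _∷_; length; sum)
open import Data.List.Membership.Propositional using (_∈_)
import Data.List.Membership.Propositional.Properties as Membershipₚ
import Data.List.Properties as Listₚ
open import Data.List.Relation.Unary.All using (All; []; _∷_)
import Data.List.Relation.Unary.All.Properties as Allₚ
open import Data.List.Relation.Unary.AllPairs using (AllPairs; []; _∷_)
import Data.List.Relation.Unary.AllPairs.Properties as AllPairsₚ
open import Data.Nat.Base as ℕ using (ℕ; zero; suc; NonZero; z≤n; s≤s; _+_; _∸_; _≤_; _<_; _>_)
open import Data.Nat.Divisibility using (_∣_; divides)
open import Data.Nat.DivMod using (_/_; _%_; m≡m%n+[m/n]*n; m%n<n; m*n/n≡m)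
import Data.Nat.Properties as ℕₚ
import Data.Nat.Solver as ℕSolver
open import Data.Product.Base using (_×_; _,_; proj₁; proj₂; ∃-syntax)
open import Data.Sum.Base using (_⊎_; inj₁; inj₂)
open import Data.Vec.Base as Vec using (Vec)
open import Data.Vec.Functional as Vector using (Vector; updateAt)
open import Data.Vec.Functional.Properties
  using (updateAt-updates; updateAt-minimal; updateAt-commutes; updateAt-id-local)
import Data.Vec.Properties as Vecₚ
open import Function.Base using (_∘_; id; const)
open import Function.Bundles using (_⇔_; mk⇔)
open import Function.Definitions using (Injective)
open import Level using (_⊔_)
open import Relation.Binary.Definitions using (tri<; tri≈; tri>)
open import Relation.Binary.PropositionalEquality as ≡ using (_≡_; _≢_)
import Relation.Binary.Reasoning.Setoid as SetoidReasoning
open import Relation.Nullary using (¬_; yes; no; contradiction)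
open import Relation.Nullary.Decidable using (¬?)
open import Tactic.RingSolver.Core.Expression using (Κ; _⊗_)

-- Multilinear algebra of determinants, and row spaces over a commutative ring.

module RowSpace {c ℓ} (R : CommutativeRing c ℓ) where

  open CommutativeRing R hiding (zero) renaming (_+_ to _⊹_)
  open Schur R
  open RawMonoidDefs +-rawMonoid using () renaming (sum to ∑)
  open SetoidReasoning setoid

  infixl 9 _[_≔_]
  _[_≔_] : ∀ {n} → Matrix n → Fin n → Vector Carrier n → Matrix n
  M [ r ≔ v ] = updateAt M r (const v)

  det-cong-rows : ∀ {n} {A B : Matrix n} → (∀ i → A i ≡ B i) → det A ≈ det B
  det-cong-rows {A = A} {B} A≡B =
    det-cong {A = A} {B} λ i j → reflexive (≡.cong-app (A≡B i) j)

  det-[≔]-cong : ∀ {n} (M : Matrix n) r {u v} → (∀ j → u j ≈ v j) →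
                 det (M [ r ≔ u ]) ≈ det (M [ r ≔ v ])
  det-[≔]-cong M r {u} {v} u≈v = det-cong {A = M [ r ≔ u ]} {M [ r ≔ v ]} rows
    where
    rows : ∀ i j → (M [ r ≔ u ]) i j ≈ (M [ r ≔ v ]) i j
    rows i j with i Finₚ.≟ r
    ... | yes ≡.refl = trans (reflexive (≡.cong-app (updateAt-updates r M) j))
      (trans (u≈v j) (sym (reflexive (≡.cong-app (updateAt-updates r M) j))))
    ... | no i≢r = trans (reflexive (≡.cong-app (updateAt-minimal i r M i≢r) j))
      (sym (reflexive (≡.cong-app (updateAt-minimal i r M i≢r) j)))

  det-[≔]-linear : ∀ {n} (M : Matrix n) r s (u v : Vector Carrier n) →
    det (M [ r ≔ (λ j → u j ⊹ s * v j) ]) ≈ det (M [ r ≔ u ]) ⊹ s * det (M [ r ≔ v ])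
  det-[≔]-linear M r s u v = det-linear r s
    (λ i j i≢r → reflexive (≡.cong-app (off i i≢r) j))
    (λ i j i≢r → reflexive (≡.cong-app (off i i≢r) j))
    λ j → trans (at _ j) (sym (+-cong (at u j) (*-congˡ (at v j))))
    where
    off : ∀ {w w′} i → i ≢ r → (M [ r ≔ w ]) i ≡ (M [ r ≔ w′ ]) i
    off i i≢r = ≡.trans (updateAt-minimal i r M i≢r) (≡.sym (updateAt-minimal i r M i≢r))
    at : ∀ w j → (M [ r ≔ w ]) r j ≈ w j
    at w j = reflexive (≡.cong-app (updateAt-updates r M) j)

  det-[≔]-+ : ∀ {n} (M : Matrix n) r (u v : Vector Carrier n) →
    det (M [ r ≔ (λ j → u j ⊹ v j) ]) ≈ det (M [ r ≔ u ]) ⊹ det (M [ r ≔ v ])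
  det-[≔]-+ M r u v = begin
    det (M [ r ≔ (λ j → u j ⊹ v j) ])
      ≈⟨ det-[≔]-cong M r (λ j → +-congˡ (sym (*-identityˡ (v j)))) ⟩
    det (M [ r ≔ (λ j → u j ⊹ 1# * v j) ])
      ≈⟨ det-[≔]-linear M r 1# u v ⟩
    det (M [ r ≔ u ]) ⊹ 1# * det (M [ r ≔ v ])
      ≈⟨ +-congˡ (*-identityˡ _) ⟩
    det (M [ r ≔ u ]) ⊹ det (M [ r ≔ v ]) ∎

  -- A zero row is its own double, so by additivity the determinant is its own double too, and
  -- cancellation leaves 0.
  det-[≔]-zero : ∀ {n} (M : Matrix n) r {v} → (∀ j → v j ≈ 0#) → det (M [ r ≔ v ]) ≈ 0#
  det-[≔]-zero M r {v} v≈0 = +-cancelʳ _ _ _ (begin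
    det (M [ r ≔ v ]) ⊹ det (M [ r ≔ v ])
      ≈⟨ det-[≔]-+ M r v v ⟨
    det (M [ r ≔ (λ j → v j ⊹ v j) ])
      ≈⟨ det-[≔]-cong M r (λ j → trans (+-congʳ (v≈0 j)) (+-identityˡ (v j))) ⟩
    det (M [ r ≔ v ])
      ≈⟨ +-identityˡ _ ⟨
    0# ⊹ det (M [ r ≔ v ]) ∎)
    where open RingProps ring using (+-cancelʳ)

  det-[≔]-∑ : ∀ {n m} (M : Matrix n) r (c : Vector Carrier m) (v : Fin m → Vector Carrier n) →
    det (M [ r ≔ (λ j → ∑ λ k → c k * v k j) ]) ≈ ∑ λ k → c k * det (M [ r ≔ v k ])
  det-[≔]-∑ {m = zero}  M r c v = det-[≔]-zero M r λ _ → refl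
  det-[≔]-∑ {m = suc m} M r c v = begin
    det (M [ r ≔ (λ j → c zero * v zero j ⊹ tail j) ])
      ≈⟨ det-[≔]-cong M r (λ j → +-comm (c zero * v zero j) (tail j)) ⟩
    det (M [ r ≔ (λ j → tail j ⊹ c zero * v zero j) ])
      ≈⟨ det-[≔]-linear M r (c zero) tail (v zero) ⟩
    det (M [ r ≔ tail ]) ⊹ c zero * det (M [ r ≔ v zero ])
      ≈⟨ +-comm _ _ ⟩
    c zero * det (M [ r ≔ v zero ]) ⊹ det (M [ r ≔ tail ])
      ≈⟨ +-congˡ (det-[≔]-∑ M r (c ∘ suc) (v ∘ suc)) ⟩
    c zero * det (M [ r ≔ v zero ]) ⊹ (∑ λ k → c (suc k) * det (M [ r ≔ v (suc k) ])) ∎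
    where
    tail : Vector Carrier _
    tail j = ∑ λ k → c (suc k) * v (suc k) j

  det-equal-rows : ∀ {n} (M : Matrix n) {a b} → a ≢ b → (∀ j → M a j ≈ M b j) → det M ≈ 0#
  det-equal-rows M {a} {b} a≢b Ma≈Mb with Finₚ.<-cmp a b
  ... | tri< a<b _ _ = det-alternating M a b a<b Ma≈Mb
  ... | tri≈ _ a≡b _ = contradiction a≡b a≢b
  ... | tri> _ _ b<a = det-alternating M b a b<a (sym ∘ Ma≈Mb)

  ∑-single : ∀ {n} (r : Fin n) (f : Vector Carrier n) → (∀ i → i ≢ r → f i ≈ 0#) → ∑ f ≈ f r
  ∑-single zero    f f≈0 = trans (+-congˡ (sum-zero λ i → f≈0 (suc i) λ ())) (+-identityʳ _)
  ∑-single (suc r) f f≈0 = trans (+-cong (f≈0 zero λ ())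
    (∑-single r (f ∘ suc) λ i i≢r → f≈0 (suc i) (i≢r ∘ Finₚ.suc-injective))) (+-identityˡ _)

  -- Replacing row r by ∑ₖ cₖ Mₖ multiplies the determinant by cᵣ.
  det-relation : ∀ {n} (M : Matrix n) (c : Vector Carrier n) →
    (∀ j → (∑ λ k → c k * M k j) ≈ 0#) → ∀ r → c r * det M ≈ 0#
  det-relation M c relation r = begin
    c r * det M
      ≈⟨ *-congˡ (det-cong-rows (λ i → ≡.sym (updateAt-id-local r M ≡.refl i))) ⟩
    c r * det (M [ r ≔ M r ])
      ≈⟨ ∑-single r (λ k → c k * det (M [ r ≔ M k ])) (λ k k≢r → trans (*-congˡ
           (det-equal-rows (M [ r ≔ M k ]) k≢r λ j → reflexive (≡.cong-app (≡.trans
             (updateAt-minimal k r M k≢r) (≡.sym (updateAt-updates r M))) j)))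
           (zeroʳ (c k))) ⟨
    (∑ λ k → c k * det (M [ r ≔ M k ]))
      ≈⟨ det-[≔]-∑ M r c M ⟨
    det (M [ r ≔ (λ j → ∑ λ k → c k * M k j) ])
      ≈⟨ det-[≔]-zero M r relation ⟩
    0# ∎

  -- Polarisation: with `u + v` in both rows the determinant is 0. Expanding it gives four terms,
  -- and the two with equal rows vanish.
  det-swap : ∀ {n} (M : Matrix n) {a b} → a ≢ b → ∀ u v →
             det (M [ a ≔ u ] [ b ≔ v ]) ⊹ det (M [ a ≔ v ] [ b ≔ u ]) ≈ 0#
  det-swap M {a} {b} a≢b u v = begin
    D u v ⊹ D v u
      ≈⟨ +-cong (+-identityˡ _) (+-identityʳ _) ⟨
    (0# ⊹ D u v) ⊹ (D v u ⊹ 0#)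
      ≈⟨ +-cong (+-congʳ (D-diag u)) (+-congˡ (D-diag v)) ⟨
    (D u u ⊹ D u v) ⊹ (D v u ⊹ D v v)
      ≈⟨ +-cong (det-[≔]-+ (M [ a ≔ u ]) b u v) (det-[≔]-+ (M [ a ≔ v ]) b u v) ⟨
    D u u+v ⊹ D v u+v
      ≈⟨ +-cong (D-comm u) (D-comm v) ⟩
    det (M [ b ≔ u+v ] [ a ≔ u ]) ⊹ det (M [ b ≔ u+v ] [ a ≔ v ])
      ≈⟨ det-[≔]-+ (M [ b ≔ u+v ]) a u v ⟨
    det (M [ b ≔ u+v ] [ a ≔ u+v ])
      ≈⟨ D-comm u+v ⟨
    D u+v u+v
      ≈⟨ D-diag u+v ⟩
    0# ∎
    where
    u+v : Vector Carrier _
    u+v j = u j ⊹ v j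
    D : Vector Carrier _ → Vector Carrier _ → Carrier
    D x y = det (M [ a ≔ x ] [ b ≔ y ])
    D-comm : ∀ x {y} → D x y ≈ det (M [ b ≔ y ] [ a ≔ x ])
    D-comm x = det-cong-rows (updateAt-commutes b a (a≢b ∘ ≡.sym) M)
    D-diag : ∀ x → D x x ≈ 0#
    D-diag x = det-equal-rows (M [ a ≔ x ] [ b ≔ x ]) a≢b λ j → reflexive (≡.cong-app (≡.trans
      (updateAt-minimal a b (M [ a ≔ x ]) a≢b) (≡.trans (updateAt-updates a M)
        (≡.sym (updateAt-updates b (M [ a ≔ x ]))))) j)

  det-swap-rows : ∀ {n} (A B : Matrix n) {a b} → a ≢ b → A a ≡ B b → A b ≡ B a →
                  (∀ i → i ≢ a → i ≢ b → A i ≡ B i) → det A ⊹ det B ≈ 0#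
  det-swap-rows A B {a} {b} a≢b Aa≡Bb Ab≡Ba A≡B = trans
    (+-cong (det-cong-rows (rows A ≡.refl ≡.refl λ i _ _ → ≡.refl))
            (det-cong-rows (rows B (≡.sym Ab≡Ba) (≡.sym Aa≡Bb) λ i i≢a i≢b → ≡.sym (A≡B i i≢a i≢b))))
    (det-swap A a≢b (A a) (A b))
    where
    rows : ∀ (C : Matrix _) {u v} → C a ≡ u → C b ≡ v → (∀ i → i ≢ a → i ≢ b → C i ≡ A i) →
           ∀ i → C i ≡ (A [ a ≔ u ] [ b ≔ v ]) i
    rows C {u} {v} Ca Cb C≡A i with i Finₚ.≟ b | i Finₚ.≟ a
    ... | yes ≡.refl | _ = ≡.trans Cb (≡.sym (updateAt-updates b (A [ a ≔ u ])))
    ... | no i≢b | yes ≡.refl = ≡.trans Ca (≡.sym (≡.trans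
      (updateAt-minimal a b (A [ a ≔ u ]) i≢b) (updateAt-updates a A)))
    ... | no i≢b | no i≢a = ≡.trans (C≡A i i≢a i≢b) (≡.sym (≡.trans
      (updateAt-minimal i b (A [ a ≔ u ]) i≢b) (updateAt-minimal i a A i≢a)))

  -- One step of a selection sort of `f`. If `f` misses `r`, two of its values coincide by the
  -- pigeonhole principle and two rows are equal. Otherwise transposing `r` with its preimage
  -- extends the range on which the map is the identity, at the cost of a sign.
  det-reindex-step : ∀ {n} (M : Matrix n) (r : Fin n) (f : Fin n → Fin n) →
    (∀ i → i Fin.< r → f i ≡ i) →
    (∀ g → (∀ i → i Fin.≤ r → g i ≡ i) → det (M ∘ g) ≈ 0#) → det (M ∘ f) ≈ 0#
  det-reindex-step {suc n} M r f fix rec with Finₚ.any? (λ i → f i Finₚ.≟ r)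
  ... | no r∉f =
    let r≢f i r≡fi = r∉f (i , ≡.sym r≡fi)
        i , j , i<j , eq = Finₚ.pigeonhole (ℕₚ.n<1+n n) λ i → punchOut (r≢f i)
    in det-alternating (M ∘ f) i j i<j λ l → reflexive (≡.cong (λ a → M a l)
         (Finₚ.punchOut-injective (r≢f i) (r≢f j) eq))
  ... | yes (i , fi≡r) with i Finₚ.≟ r
  ...   | yes i≡r = rec f f-fix
    where
    f-fix : ∀ l → l Fin.≤ r → f l ≡ l
    f-fix l l≤r with l Finₚ.≟ r
    ... | yes l≡r = ≡.trans (≡.cong f (≡.trans l≡r (≡.sym i≡r))) (≡.trans fi≡r (≡.sym l≡r))
    ... | no l≢r = fix l (ℕₚ.≤∧≢⇒< l≤r (l≢r ∘ Finₚ.toℕ-injective))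
  ...   | no i≢r = trans (sym (+-identityʳ _)) (trans (+-congˡ (sym (rec g g-fix)))
    (det-swap-rows (M ∘ f) (M ∘ g) i≢r
      (≡.cong M (≡.sym gr)) (≡.cong M (≡.sym gi)) λ l l≢i l≢r → ≡.cong M (≡.sym (gl l l≢i l≢r))))
    where
    f′ g : Vector (Fin (suc n)) (suc n)
    f′ = updateAt f r (const (f i))
    g  = updateAt f′ i (const (f r))
    gi : g i ≡ f r
    gi = updateAt-updates i f′
    gr : g r ≡ f i
    gr = ≡.trans (updateAt-minimal r i f′ (i≢r ∘ ≡.sym)) (updateAt-updates r f)
    gl : ∀ l → l ≢ i → l ≢ r → g l ≡ f l
    gl l l≢i l≢r = ≡.trans (updateAt-minimal l i f′ l≢i) (updateAt-minimal l r f l≢r)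
    g-fix : ∀ l → l Fin.≤ r → g l ≡ l
    g-fix l l≤r with l Finₚ.≟ r
    ... | yes ≡.refl = ≡.trans gr fi≡r
    ... | no l≢r = ≡.trans (gl l l≢i l≢r) fl≡l
      where
      fl≡l : f l ≡ l
      fl≡l = fix l (ℕₚ.≤∧≢⇒< l≤r (l≢r ∘ Finₚ.toℕ-injective))
      l≢i : l ≢ i
      l≢i ≡.refl = i≢r (≡.trans (≡.sym fl≡l) fi≡r)

  det-reindex : ∀ {n} (M : Matrix n) → det M ≈ 0# → ∀ (f : Fin n → Fin n) → det (M ∘ f) ≈ 0#
  det-reindex {n} M detM≈0 f = go n 0 ≡.refl f λ _ ()
    where
    -- The first `k` positions are sorted and `m` remain; with none left the map is the identity.
    go : ∀ m k → k + m ≡ n → ∀ f → (∀ i → toℕ i < k → f i ≡ i) → det (M ∘ f) ≈ 0#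
    go zero k k≡n f fix = trans (det-cong-rows λ i → ≡.cong M (fix i
      (≡.subst (toℕ i <_) (≡.trans (≡.sym k≡n) (ℕₚ.+-identityʳ k)) (Finₚ.toℕ<n i)))) detM≈0
    go (suc m) k k+m≡n f fix = det-reindex-step M (fromℕ< k<n) f
      (λ i i<r → fix i (≡.subst (toℕ i <_) r≡k i<r))
      λ g g-fix → go m (suc k) (≡.trans (≡.sym (ℕₚ.+-suc k m)) k+m≡n) g
        λ i i<1+k → g-fix i (≡.subst (toℕ i ≤_) (≡.sym r≡k) (ℕₚ.≤-pred i<1+k))
      where
      k<n : k < n
      k<n = ≡.subst (k <_) k+m≡n (ℕₚ.m<m+n k (s≤s z≤n))
      r≡k = Finₚ.toℕ-fromℕ< k<n

  -- Membership is a derivation and not a vector of coefficients, so that determinants can be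
  -- expanded by recursion on it.
  data Span {n} (M : Matrix n) : Vector Carrier n → Set (c ⊔ ℓ) where
    row     : ∀ i {v} → (∀ j → v j ≈ M i j) → Span M v
    zero    : ∀ {v} → (∀ j → v j ≈ 0#) → Span M v
    combine : ∀ {u v w} s → Span M u → Span M v → (∀ j → w j ≈ u j ⊹ s * v j) → Span M w

  -- Rows of A in the span of M are replaced by rows of M one at a time.
  det-span : ∀ {n} (M : Matrix n) → det M ≈ 0# →
             ∀ (A : Matrix n) → (∀ i → Span M (A i)) → det A ≈ 0#
  det-span {n} M detM≈0 A A∈M = go n ℕₚ.≤-refl A A∈M λ i n≤i →
    contradiction (Finₚ.toℕ<n i) (ℕₚ.≤⇒≯ n≤i)
    where
    IsRow : Vector Carrier n → Set ℓ
    IsRow v = ∃[ l ] (∀ j → v j ≈ M l j)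
    go : ∀ k → k ≤ n → ∀ A → (∀ i → Span M (A i)) → (∀ i → k ≤ toℕ i → IsRow (A i)) → det A ≈ 0#
    -- All rows of `A` are now rows of `M`, possibly repeated, so `A` is `M` reindexed by a map that
    -- may fail to be a permutation.
    go zero _ A _ rows = trans
      (det-cong {A = A} {B = M ∘ f} λ i → proj₂ (rows i z≤n)) (det-reindex M detM≈0 f)
      where
      f : Fin n → Fin n
      f i = proj₁ (rows i z≤n)
    go (suc k) k<n A A∈M rows = trans
      (det-cong-rows (λ i → ≡.sym (updateAt-id-local r A ≡.refl i))) (replaced (A∈M r))
      where
      r = fromℕ< k<n
      replaced : ∀ {v} → Span M v → det (A [ r ≔ v ]) ≈ 0#
      replaced {v} v∈M@(row l v≈Ml) = go k (ℕₚ.<⇒≤ k<n) (A [ r ≔ v ]) spanned rows′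
        where
        spanned : ∀ i → Span M ((A [ r ≔ v ]) i)
        spanned i with i Finₚ.≟ r
        ... | yes ≡.refl = ≡.subst (Span M) (≡.sym (updateAt-updates r A)) v∈M
        ... | no i≢r = ≡.subst (Span M) (≡.sym (updateAt-minimal i r A i≢r)) (A∈M i)
        rows′ : ∀ i → k ≤ toℕ i → IsRow ((A [ r ≔ v ]) i)
        rows′ i k≤i with i Finₚ.≟ r
        ... | yes ≡.refl = ≡.subst IsRow (≡.sym (updateAt-updates r A)) (l , v≈Ml)
        ... | no i≢r = ≡.subst IsRow (≡.sym (updateAt-minimal i r A i≢r)) (rows i
          (ℕₚ.≤∧≢⇒< k≤i λ k≡i → i≢r (Finₚ.toℕ-injective
            (≡.trans (≡.sym k≡i) (≡.sym (Finₚ.toℕ-fromℕ< k<n))))))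
      replaced (zero v≈0) = det-[≔]-zero A r v≈0
      replaced {w} (combine {u} {v} s u∈M v∈M w≈) = begin
        det (A [ r ≔ w ])
          ≈⟨ det-[≔]-cong A r w≈ ⟩
        det (A [ r ≔ (λ j → u j ⊹ s * v j) ])
          ≈⟨ det-[≔]-linear A r s u v ⟩
        det (A [ r ≔ u ]) ⊹ s * det (A [ r ≔ v ])
          ≈⟨ +-cong (replaced u∈M) (trans (*-congˡ (replaced v∈M)) (zeroʳ s)) ⟩
        0# ⊹ 0#
          ≈⟨ +-identityˡ 0# ⟩
        0# ∎

  -- Regular elements play the part of nonzero scalars: they can be cancelled and multiplied
  -- together in any commutative ring, with neither division nor a decision whether an element is 0.
  Regular : Carrier → Set (c ⊔ ℓ)
  Regular a = ∀ y → a * y ≈ 0# → y ≈ 0#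

  regular-1 : Regular 1#
  regular-1 y 1y≈0 = trans (sym (*-identityˡ y)) 1y≈0

  regular-* : ∀ {a b} → Regular a → Regular b → Regular (a * b)
  regular-* {a} {b} a-reg b-reg y aby≈0 = b-reg y (a-reg (b * y) (trans (sym (*-assoc a b y)) aby≈0))

  regular-resp : ∀ {a b} → a ≈ b → Regular a → Regular b
  regular-resp a≈b a-reg y by≈0 = a-reg y (trans (*-congʳ a≈b) by≈0)

  regular-prod : ∀ {n} {d : Vector Carrier n} → (∀ i → Regular (d i)) → Regular (prod d)
  regular-prod {zero}  d-reg = regular-1
  regular-prod {suc n} d-reg = regular-* (d-reg zero) (regular-prod (d-reg ∘ suc))

  identity : ∀ {n} → Matrix n
  identity zero    zero    = 1#
  identity zero    (suc j) = 0#
  identity (suc i) zero    = 0#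
  identity (suc i) (suc j) = identity i j

  identity-diagonal : ∀ {n} (i : Fin n) → identity i i ≈ 1#
  identity-diagonal zero    = refl
  identity-diagonal (suc i) = identity-diagonal i

  identity-off-diagonal : ∀ {n} {i j : Fin n} → j ≢ i → identity i j ≈ 0#
  identity-off-diagonal {i = zero}  {zero}  j≢i = contradiction ≡.refl j≢i
  identity-off-diagonal {i = zero}  {suc j} j≢i = refl
  identity-off-diagonal {i = suc i} {zero}  j≢i = refl
  identity-off-diagonal {i = suc i} {suc j} j≢i = identity-off-diagonal (j≢i ∘ ≡.cong suc)

  det-identity : ∀ {n} → det (identity {n}) ≈ 1#
  det-identity {zero}  = refl
  det-identity {suc n} = begin
    det I
      ≈⟨ +-cong (trans (*-identityˡ _) (trans (*-identityˡ _) (det-identity {n})))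
           (sum-zero λ j → trans (*-congˡ {sign (suc j)} (zeroˡ (det (minor I (suc j)))))
             (zeroʳ (sign (suc j)))) ⟩
    1# ⊹ 0#
      ≈⟨ +-identityʳ 1# ⟩
    1# ∎
    where
    I : Matrix (suc n)
    I = identity

  SpansUnit : ∀ {n} → Matrix n → Fin n → Set (c ⊔ ℓ)
  SpansUnit M i = ∃[ v ] (Span M v × Regular (v i) × (∀ j → j ≢ i → v j ≈ 0#))

  -- The given multiples of unit vectors form a diagonal matrix with regular determinant. Its rows
  -- lie in the span of `M`, so `det M ≈ 0` would make that regular determinant 0 and force
  -- `1# ≈ 0#`.
  det≉0 : ∀ {n} (M : Matrix n) → ¬ 1# ≈ 0# → (∀ i → SpansUnit M i) → ¬ det M ≈ 0#
  det≉0 {n} M 1≉0 units detM≈0 = 1≉0 (regular-prod {d = d} d-regular 1# (begin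
    prod d * 1#
      ≈⟨ *-congˡ (det-identity {n}) ⟨
    prod d * det (identity {n})
      ≈⟨ det-scale d (identity {n}) ⟨
    det (λ i j → d i * identity i j)
      ≈⟨ det-cong {A = A} {B = λ i j → d i * identity i j} entry ⟨
    det A
      ≈⟨ det-span M detM≈0 A (λ i → proj₁ (proj₂ (units i))) ⟩
    0# ∎))
    where
    A : Matrix n
    A i = proj₁ (units i)
    d : Vector Carrier n
    d i = A i i
    d-regular : ∀ i → Regular (d i)
    d-regular i = proj₁ (proj₂ (proj₂ (units i)))
    entry : ∀ i j → A i j ≈ d i * identity i j
    entry i j with j Finₚ.≟ i
    ... | yes ≡.refl = sym (trans (*-congˡ (identity-diagonal i)) (*-identityʳ (d i)))
    ... | no j≢i = trans (proj₂ (proj₂ (proj₂ (units i))) j j≢i)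
      (sym (trans (*-congˡ (identity-off-diagonal j≢i)) (zeroʳ (d i))))

-- Divided differences and Newton interpolation.

module DividedDifferences {c ℓ} (R : CommutativeRing c ℓ) {N : ℕ} where

  open CommutativeRing R hiding (zero) renaming (_+_ to _⊹_)
  open Schur R
  open RowSpace R
  open RawMonoidDefs +-rawMonoid using () renaming (sum to ∑)
  open ExpProps semiring using (_^_)
  open SumProps semiring using (sum-cong-≋; ∑-distrib-+; *-distribʳ-sum)
  open Solver commutativeSemiring using (solve; _:+_; _:*_; _:=_; con)
  open SetoidReasoning setoid

  -- The latest node comes first: xᵢ, ..., x₀, then `p`. On this list `homog m` is the divided
  -- difference of the monomial of exponent `m`.
  nodes : ∀ {n} → List (Fin N) → Vector (Fin N) n → Fin n → List (Fin N)
  nodes p x zero    = x zero ∷ p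
  nodes p x (suc i) = nodes (x zero ∷ p) (x ∘ suc) i

  module _ (ρ : Vec Carrier N) where

    -- `newton` is this determinant written as a Laplace expansion: removing the first row moves x₀
    -- to the nodes already used.
    newton≈det : ∀ {n} p (x : Vector (Fin N) n) e →
      ⟦ newton p x e ⟧ ρ ≈ det λ i j → ⟦ homog (e j) (nodes p x i) ⟧ ρ
    newton≈det {zero}  p x e = refl
    newton≈det {suc n} p x e = trans
      (⟦sumᴱ⟧ ρ λ j → Κ (sign j) ⊗
        (homog (e j) (x zero ∷ p) ⊗ newton (x zero ∷ p) (x ∘ suc) (e ∘ punchIn j)))
      (sum-cong-≋ λ j → *-congˡ {sign j} (*-congˡ {⟦ homog (e j) (x zero ∷ p) ⟧ ρ}
        (newton≈det (x zero ∷ p) (x ∘ suc) (e ∘ punchIn j))))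

    -- The coefficients of the functional f ↦ ∑ᵢ cᵢ f(xᵢ) in terms of the divided
    -- differences f ↦ f[x₀, …, xₖ].
    newtonCoefficients : ∀ {n} → Vector (Fin N) n → Vector Carrier n → Vector Carrier n
    newtonCoefficients x c zero    = ∑ c
    newtonCoefficients x c (suc k) =
      newtonCoefficients (x ∘ suc) (λ i → c (suc i) * (X ρ (x (suc i)) - X ρ (x zero))) k

    -- Each f(xᵢ) is f(x₀) + (xᵢ - x₀) f[x₀, xᵢ]. The values f(x₀) collect into the coefficient
    -- `∑ c`; what remains is a functional on the first divided differences at the later nodes,
    -- handled by induction.
    newton-expansion : ∀ {n} m p (x : Vector (Fin N) n) c →
      (∑ λ i → c i * ⟦ homog m (x i ∷ p) ⟧ ρ) ≈
      ∑ λ k → newtonCoefficients x c k * ⟦ homog m (nodes p x k) ⟧ ρ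
    newton-expansion {zero}  m p x c = refl
    newton-expansion {suc n} m p x c = begin
      c zero * h ⊹ (∑ λ i → c (suc i) * ⟦ homog m (x (suc i) ∷ p) ⟧ ρ)
        ≈⟨ +-congˡ (sum-cong-≋ λ i → trans
             (*-congˡ (homog-difference ρ m (x (suc i)) (x zero) p))
             (solve 4 (λ c d g h → c :* (d :* g :+ con 1 :* h) := c :* h :+ c :* d :* g) refl
               (c (suc i)) (X ρ (x (suc i)) - X ρ (x zero)) (g i) h)) ⟩
      c zero * h ⊹ (∑ λ i → c (suc i) * h ⊹ c′ i * g i)
        ≈⟨ +-congˡ (∑-distrib-+ (λ i → c (suc i) * h) (λ i → c′ i * g i)) ⟩
      c zero * h ⊹ ((∑ λ i → c (suc i) * h) ⊹ (∑ λ i → c′ i * g i))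
        ≈⟨ +-assoc _ _ _ ⟨
      (∑ λ i → c i * h) ⊹ (∑ λ i → c′ i * g i)
        ≈⟨ +-cong (sym (*-distribʳ-sum h c)) (newton-expansion m (x zero ∷ p) (x ∘ suc) c′) ⟩
      (∑ λ k → newtonCoefficients x c k * ⟦ homog m (nodes p x k) ⟧ ρ) ∎
      where
      h : Carrier
      h = ⟦ homog m (x zero ∷ p) ⟧ ρ
      c′ g : Vector Carrier n
      c′ i = c (suc i) * (X ρ (x (suc i)) - X ρ (x zero))
      g i = ⟦ homog m (x (suc i) ∷ x zero ∷ p) ⟧ ρ

    -- For cᵢ = 0 nothing is required of xᵢ.
    Separated : ∀ {n} → Vector (Fin N) n → Vector Carrier n → Set (c ⊔ ℓ)
    Separated x c = ∀ {l i} → l Fin.< i →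
      ∀ y → c i * ((X ρ (x i) - X ρ (x l)) * y) ≈ 0# → c i * y ≈ 0#

    -- The passage from `c` to its Newton coefficients is triangular, with products of node
    -- differences on the diagonal. Separation cancels these for the later entries, and then the
    -- coefficient `∑ c` leaves only `c zero`.
    newtonCoefficients-annihilated : ∀ {n} (x : Vector (Fin N) n) c d → Separated x c →
      (∀ k → newtonCoefficients x c k * d ≈ 0#) → ∀ i → c i * d ≈ 0#
    newtonCoefficients-annihilated {suc n} x c d separated Cd≈0 = λ where
        zero    → begin
          c zero * d
            ≈⟨ +-identityʳ _ ⟨
          c zero * d ⊹ 0#
            ≈⟨ +-congˡ (sum-zero tail) ⟨
          c zero * d ⊹ (∑ λ i → c (suc i) * d)
            ≈⟨ *-distribʳ-sum d c ⟨
          ∑ c * d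
            ≈⟨ Cd≈0 zero ⟩
          0# ∎
        (suc i) → tail i
      where
      δ c′ : Vector Carrier n
      δ i = X ρ (x (suc i)) - X ρ (x zero)
      c′ i = c (suc i) * δ i
      separated′ : Separated (x ∘ suc) c′
      -- The factor `δ i` that distinguishes `c′` from `c` is moved into the universally quantified
      -- `y`.
      separated′ {l} {i} l<i y eq = trans (*-assoc _ _ _) (separated (s≤s l<i) (δ i * y) (trans
        (solve 4 (λ c a d y → c :* (a :* (d :* y)) := c :* d :* (a :* y)) refl
          (c (suc i)) (X ρ (x (suc i)) - X ρ (x (suc l))) (δ i) y) eq))
      tail : ∀ i → c (suc i) * d ≈ 0#
      tail i = separated (s≤s z≤n) d (trans (sym (*-assoc _ _ _))
        (newtonCoefficients-annihilated (x ∘ suc) c′ d separated′ (Cd≈0 ∘ suc) i))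

    -- A relation between the rows of powers becomes, through the Newton expansion, a relation
    -- between the rows of divided differences. Working with the latter leaves no Vandermonde factor
    -- to cancel, so nodes with coefficient 0 may coincide.
    newton-annihilated : ∀ (e : Vector ℕ N) c → Separated id c →
      (∀ j → (∑ λ i → c i * X ρ i ^ e j) ≈ 0#) → ∀ i → c i * ⟦ newton [] id e ⟧ ρ ≈ 0#
    newton-annihilated e c separated relation i = trans (*-congˡ (newton≈det [] id e))
      (newtonCoefficients-annihilated id c _ separated
        (det-relation (λ i j → ⟦ homog (e j) (nodes [] id i) ⟧ ρ) (newtonCoefficients id c) λ j → begin
          (∑ λ k → newtonCoefficients id c k * ⟦ homog (e j) (nodes [] id k) ⟧ ρ)
            ≈⟨ newton-expansion (e j) [] id c ⟨
          (∑ λ i → c i * ⟦ homog (e j) (i ∷ []) ⟧ ρ)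
            ≈⟨ sum-cong-≋ (λ i → *-congˡ {c i} (homog-single ρ (e j) i)) ⟩
          (∑ λ i → c i * X ρ i ^ e j)
            ≈⟨ relation j ⟩
          0# ∎) i)

-- Split index sets, powers and geometric sums.

↑-elim : ∀ {p} m {n} (P : Fin (m + n) → Set p) →
         (∀ i → P (i ↑ˡ n)) → (∀ i → P (m ↑ʳ i)) → ∀ i → P i
↑-elim zero    P Pˡ Pʳ i       = Pʳ i
↑-elim (suc m) P Pˡ Pʳ zero    = Pˡ zero
↑-elim (suc m) P Pˡ Pʳ (suc i) = ↑-elim m (P ∘ suc) (Pˡ ∘ suc) Pʳ i

module Powers {c ℓ} (R : CommutativeRing c ℓ) where

  open CommutativeRing R hiding (zero) renaming (_+_ to _⊹_)
  open RowSpace R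
  open RawMonoidDefs +-rawMonoid using () renaming (sum to ∑)
  open ExpProps semiring using (_^_; ^-homo-*; ^-congʳ)
  open RingProps ring using (+-cancelʳ; x[y-z]≈xy-xz; [y-z]x≈yx-zx)
  open SumProps semiring using (*-distribˡ-sum)
  open Solver commutativeSemiring using (solve; _:+_; _:*_; _:=_; con)
  open SetoidReasoning setoid

  1^ : ∀ n → 1# ^ n ≈ 1#
  1^ zero    = refl
  1^ (suc n) = trans (*-identityˡ _) (1^ n)

  regular-factor : ∀ {a b} → Regular (a * b) → Regular a
  regular-factor {a} {b} ab-reg y ay≈0 = ab-reg y (trans
    (solve 3 (λ a b y → a :* b :* y := b :* (a :* y)) refl a b y)
    (trans (*-congˡ ay≈0) (zeroʳ b)))

  regular-^ : ∀ {a} n → Regular a → Regular (a ^ n)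
  regular-^ zero    a-reg = regular-1
  regular-^ (suc n) a-reg = regular-* a-reg (regular-^ n a-reg)

  -- The identity (y - 1) S = yⁿ - 1 is kept free of subtraction, within reach of a solver for
  -- commutative semirings.
  geometric-sum : ∀ n y → y * (∑ {n} λ i → y ^ toℕ i) ⊹ 1# ≈ (∑ {n} λ i → y ^ toℕ i) ⊹ y ^ n
  geometric-sum zero    y = +-congʳ (zeroʳ y)
  geometric-sum (suc n) y = begin
    y * (1# ⊹ (∑ {n} λ i → y * y ^ toℕ i)) ⊹ 1#
      ≈⟨ +-congʳ (*-congˡ (+-congˡ (*-distribˡ-sum y (λ (i : Fin n) → y ^ toℕ i)))) ⟨
    y * (1# ⊹ y * S) ⊹ 1#
      ≈⟨ solve 2 (λ y S → y :* (con 1 :+ y :* S) :+ con 1 := con 1 :+ y :* (y :* S :+ con 1)) refl y S ⟩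
    1# ⊹ y * (y * S ⊹ 1#)
      ≈⟨ +-congˡ (*-congˡ (geometric-sum n y)) ⟩
    1# ⊹ y * (S ⊹ y ^ n)
      ≈⟨ solve 3 (λ y S p → con 1 :+ y :* (S :+ p) := con 1 :+ y :* S :+ y :* p) refl y S (y ^ n) ⟩
    (1# ⊹ y * S) ⊹ y * y ^ n
      ≈⟨ +-congʳ (+-congˡ (*-distribˡ-sum y (λ (i : Fin n) → y ^ toℕ i))) ⟩
    (1# ⊹ (∑ {n} λ i → y * y ^ toℕ i)) ⊹ y * y ^ n ∎
    where
    S : Carrier
    S = ∑ {n} λ i → y ^ toℕ i

  geometric-sum≈0 : ∀ n {y} → y ^ n ≈ 1# → Regular (y - 1#) → (∑ {n} λ i → y ^ toℕ i) ≈ 0#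
  geometric-sum≈0 n {y} y^n≈1 y-1-reg = y-1-reg S (begin
    (y - 1#) * S
      ≈⟨ [y-z]x≈yx-zx S y 1# ⟩
    y * S - 1# * S
      ≈⟨ +-cong (+-cancelʳ 1# (y * S) S (trans (geometric-sum n y) (+-congˡ y^n≈1)))
           (-‿cong (*-identityˡ S)) ⟩
    S - S
      ≈⟨ -‿inverseʳ S ⟩
    0# ∎)
    where
    S : Carrier
    S = ∑ {n} λ i → y ^ toℕ i

  regular-power-difference : ∀ {a} m n → m < n → Regular a → Regular (a ^ (n ∸ m) - 1#) →
                             Regular (a ^ n - a ^ m)
  regular-power-difference {a} m n m<n a-reg d-reg = regular-resp (begin
    a ^ m * (a ^ (n ∸ m) - 1#)
      ≈⟨ x[y-z]≈xy-xz _ _ _ ⟩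
    a ^ m * a ^ (n ∸ m) - a ^ m * 1#
      ≈⟨ +-cong (sym (^-homo-* a m (n ∸ m))) (-‿cong (*-identityʳ _)) ⟩
    a ^ (m + (n ∸ m)) - a ^ m
      ≈⟨ +-congʳ (^-congʳ a (ℕₚ.m+[n∸m]≡n (ℕₚ.<⇒≤ m<n))) ⟩
    a ^ n - a ^ m ∎) (regular-* (regular-^ m a-reg) d-reg)

  ∑-++ : ∀ m {n} (f : Vector Carrier (m + n)) →
         ∑ f ≈ (∑ λ i → f (i ↑ˡ n)) ⊹ (∑ λ i → f (m ↑ʳ i))
  ∑-++ zero    f = sym (+-identityˡ _)
  ∑-++ (suc m) f = trans (+-congˡ (∑-++ m (f ∘ suc))) (sym (+-assoc _ _ _))

-- Roots of unity and the functionals that detect residue classes.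

module RootOfUnity {c ℓ} (R : CommutativeRing c ℓ) where

  open CommutativeRing R hiding (zero) renaming (_+_ to _⊹_)
  open Schur R
  open RowSpace R
  open Powers R
  open RawMonoidDefs +-rawMonoid using () renaming (sum to ∑)
  open ExpProps semiring using (_^_; ^-homo-*; ^-assocʳ; ^-congʳ; ^-congˡ)
  open SumProps semiring using (sum-cong-≋)
  open Solver commutativeSemiring using (solve; _:*_; _:=_)
  open SetoidReasoning setoid

  module _ (t : ℕ) (ζ z w : Carrier) where

    -- Definitionally equal to `point` over the ring of a Heyting field, so results about it apply
    -- to `schurValue` directly.
    points : Vec Carrier (t + 2)
    points = Vec.tabulate {n = t} (λ i → ζ ^ toℕ i) Vec.++ (z Vec.∷ w Vec.∷ Vec.[])

    points-ζ : ∀ i → Vec.lookup points (i ↑ˡ 2) ≡ ζ ^ toℕ i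
    points-ζ i = ≡.trans (Vecₚ.lookup-++ˡ (Vec.tabulate {n = t} (λ i → ζ ^ toℕ i)) _ i)
      (Vecₚ.lookup∘tabulate {n = t} (λ i → ζ ^ toℕ i) i)

    points-z : Vec.lookup points (t ↑ʳ zero) ≡ z
    points-z = Vecₚ.lookup-++ʳ (Vec.tabulate {n = t} (λ i → ζ ^ toℕ i)) _ zero

    points-w : Vec.lookup points (t ↑ʳ suc zero) ≡ w
    points-w = Vecₚ.lookup-++ʳ (Vec.tabulate {n = t} (λ i → ζ ^ toℕ i)) _ (suc zero)

  module _ (t : ℕ) .{{_ : NonZero t}} {ζ : Carrier} (ζ^t≈1 : ζ ^ t ≈ 1#)
           (ζ^k-1-regular : ∀ k → 0 < k → k < t → Regular (ζ ^ k - 1#)) where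

    ζ-regular : Regular ζ
    ζ-regular = regular-factor (regular-resp
      (trans (sym ζ^t≈1) (^-congʳ ζ (≡.sym (ℕₚ.suc-pred t)))) regular-1)

    ζ-power-periodic : ∀ q k → ζ ^ (q ℕ.* t + k) ≈ ζ ^ k
    ζ-power-periodic q k = begin
      ζ ^ (q ℕ.* t + k)
        ≈⟨ ^-homo-* ζ (q ℕ.* t) k ⟩
      ζ ^ (q ℕ.* t) * ζ ^ k
        ≈⟨ *-congʳ (^-congʳ ζ (ℕₚ.*-comm q t)) ⟩
      ζ ^ (t ℕ.* q) * ζ ^ k
        ≈⟨ *-congʳ (trans (sym (^-assocʳ ζ t q)) (trans (^-congˡ q ζ^t≈1) (1^ q))) ⟩
      1# * ζ ^ k
        ≈⟨ *-identityˡ _ ⟩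
      ζ ^ k ∎

    ζ-difference-regular : ∀ {l i} → l < i → i < t → Regular (ζ ^ i - ζ ^ l)
    ζ-difference-regular {l} {i} l<i i<t = regular-power-difference l i l<i ζ-regular
      (ζ^k-1-regular (i ∸ l) (ℕₚ.m<n⇒0<n∸m l<i) (ℕₚ.≤-<-trans (ℕₚ.m∸n≤m i l) i<t))

    -- The functional f ↦ ∑ᵢ ζ⁻ⁱʳ f(ζⁱ), evaluated at the monomial of exponent e.
    residueSum : ℕ → ℕ → Carrier
    residueSum r e = ∑ {t} λ i → (ζ ^ toℕ i) ^ (t ∸ r) * (ζ ^ toℕ i) ^ e

    -- The exponent `t ∸ r` represents -r modulo `t`. Merging the two powers and exchanging the
    -- order of exponents shows a geometric sum of ratio ζ^(e - r).
    residueSum-geometric : ∀ r e → residueSum r e ≈ ∑ {t} λ i → (ζ ^ (t ∸ r + e)) ^ toℕ i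
    residueSum-geometric r e = sum-cong-≋ {t} λ i → begin
      (ζ ^ toℕ i) ^ (t ∸ r) * (ζ ^ toℕ i) ^ e
        ≈⟨ ^-homo-* (ζ ^ toℕ i) (t ∸ r) e ⟨
      (ζ ^ toℕ i) ^ (t ∸ r + e)
        ≈⟨ ^-assocʳ ζ (toℕ i) (t ∸ r + e) ⟩
      ζ ^ (toℕ i ℕ.* (t ∸ r + e))
        ≈⟨ ^-congʳ ζ (ℕₚ.*-comm (toℕ i) (t ∸ r + e)) ⟩
      ζ ^ ((t ∸ r + e) ℕ.* toℕ i)
        ≈⟨ ^-assocʳ ζ (t ∸ r + e) (toℕ i) ⟨
      (ζ ^ (t ∸ r + e)) ^ toℕ i ∎

    ζ-power-% : ∀ s e → ζ ^ (s + e) ≈ ζ ^ (s + e % t)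
    ζ-power-% s e = begin
      ζ ^ (s + e)
        ≡⟨ ≡.cong (λ e → ζ ^ (s + e)) (m≡m%n+[m/n]*n e t) ⟩
      ζ ^ (s + (e % t + e / t ℕ.* t))
        ≡⟨ ≡.cong (ζ ^_) (≡.trans (≡.sym (ℕₚ.+-assoc s (e % t) _)) (ℕₚ.+-comm _ (e / t ℕ.* t))) ⟩
      ζ ^ (e / t ℕ.* t + (s + e % t))
        ≈⟨ ζ-power-periodic (e / t) (s + e % t) ⟩
      ζ ^ (s + e % t) ∎

    residueSum-≡ : ∀ {r} e → r < t → e % t ≡ r → residueSum r e ≈ ∑ {t} λ _ → 1#
    residueSum-≡ {r} e r<t e≡r = trans (residueSum-geometric r e) (sum-cong-≋ {t} λ i →
      trans (^-congˡ (toℕ i) (begin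
        ζ ^ (t ∸ r + e)
          ≈⟨ ζ-power-% (t ∸ r) e ⟩
        ζ ^ (t ∸ r + e % t)
          ≡⟨ ≡.cong (ζ ^_) (≡.trans (≡.cong (t ∸ r +_) e≡r) (ℕₚ.m∸n+n≡m (ℕₚ.<⇒≤ r<t))) ⟩
        ζ ^ t
          ≈⟨ ζ^t≈1 ⟩
        1# ∎)) (1^ (toℕ i)))

    -- The ratio is a t-th root of unity, and its difference from 1 is regular because its exponent
    -- is not divisible by `t`.
    residueSum-≢ : ∀ {r} e → r < t → e % t ≢ r → residueSum r e ≈ 0#
    residueSum-≢ {r} e r<t e≢r = trans (residueSum-geometric r e) (geometric-sum≈0 t
      (begin
        (ζ ^ (t ∸ r + e)) ^ t
          ≈⟨ ^-assocʳ ζ (t ∸ r + e) t ⟩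
        ζ ^ ((t ∸ r + e) ℕ.* t)
          ≡⟨ ≡.cong (ζ ^_) (ℕₚ.+-identityʳ ((t ∸ r + e) ℕ.* t)) ⟨
        ζ ^ ((t ∸ r + e) ℕ.* t + 0)
          ≈⟨ ζ-power-periodic (t ∸ r + e) 0 ⟩
        1# ∎)
      (regular-resp (+-congʳ (sym (ζ-power-% (t ∸ r) e))) regular))
      where
      a : ℕ
      a = e % t
      regular : Regular (ζ ^ (t ∸ r + a) - 1#)
      regular with ℕₚ.<-cmp a r
      ... | tri≈ _ a≡r _ = contradiction a≡r e≢r
      -- Here `t ∸ r + a` already lies strictly between 0 and `t`.
      ... | tri< a<r _ _ = ζ^k-1-regular (t ∸ r + a)
        (ℕₚ.<-≤-trans (ℕₚ.m<n⇒0<n∸m r<t) (ℕₚ.m≤m+n (t ∸ r) a))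
        (≡.subst (t ∸ r + a <_) (ℕₚ.m∸n+n≡m (ℕₚ.<⇒≤ r<t)) (ℕₚ.+-monoʳ-< (t ∸ r) a<r))
      -- Here the exponent exceeds `t`; removing one period leaves `a ∸ r`.
      ... | tri> _ _ r<a = regular-resp (+-congʳ (begin
        ζ ^ (a ∸ r)
          ≈⟨ ζ-power-periodic 1 (a ∸ r) ⟨
        ζ ^ (t + 0 + (a ∸ r))
          ≡⟨ ≡.cong (λ k → ζ ^ (k + (a ∸ r))) (≡.trans (ℕₚ.+-identityʳ t)
               (≡.sym (ℕₚ.m∸n+n≡m (ℕₚ.<⇒≤ r<t)))) ⟩
        ζ ^ (t ∸ r + r + (a ∸ r))
          ≡⟨ ≡.cong (ζ ^_) (≡.trans (ℕₚ.+-assoc (t ∸ r) r (a ∸ r))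
               (≡.cong (t ∸ r +_) (ℕₚ.m+[n∸m]≡n (ℕₚ.<⇒≤ r<a)))) ⟩
        ζ ^ (t ∸ r + a) ∎))
        (ζ^k-1-regular (a ∸ r) (ℕₚ.m<n⇒0<n∸m r<a)
          (ℕₚ.≤-<-trans (ℕₚ.m∸n≤m a r) (m%n<n e t)))

    newton-missing-residue : ∀ z w (e : Vector ℕ (t + 2)) (r : Fin t) → (∀ j → e j % t ≢ toℕ r) →
      ⟦ newton [] id e ⟧ (points t ζ z w) ≈ 0#
    -- The node indexed by `r` is just a convenient element of `Fin t`: its coefficient is a power
    -- of `ζ`, hence cancellable.
    newton-missing-residue z w e r e≢r = regular-^ (t ∸ toℕ r) (regular-^ (toℕ r) ζ-regular) _
      (trans (*-congʳ (reflexive (≡.sym (coeffˡ r))))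
        (newton-annihilated ρ e coeff separated relation (r ↑ˡ 2)))
      where
      open DividedDifferences R
      ρ : Vec Carrier (t + 2)
      ρ = points t ζ z w
      coeffs : Vec Carrier t
      coeffs = Vec.tabulate {n = t} λ i → (ζ ^ toℕ i) ^ (t ∸ toℕ r)
      coeff : Vector Carrier (t + 2)
      coeff = Vec.lookup (coeffs Vec.++ Vec.replicate 2 0#)
      coeffˡ : ∀ i → coeff (i ↑ˡ 2) ≡ (ζ ^ toℕ i) ^ (t ∸ toℕ r)
      coeffˡ i = ≡.trans (Vecₚ.lookup-++ˡ coeffs _ i)
        (Vecₚ.lookup∘tabulate {n = t} (λ i → (ζ ^ toℕ i) ^ (t ∸ toℕ r)) i)
      coeffʳ : ∀ i → coeff (t ↑ʳ i) ≡ 0#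
      coeffʳ i = ≡.trans (Vecₚ.lookup-++ʳ coeffs _ i) (Vecₚ.lookup-replicate i 0#)
      separated : Separated ρ id coeff
      -- Only differences of two roots of unity have to be regular: `z` and `w` come last, so
      -- neither precedes a root of unity, and their own coefficients are 0.
      separated {l} {i} = ↑-elim t (λ i → l Fin.< i → ∀ y →
        coeff i * ((X ρ i - X ρ l) * y) ≈ 0# → coeff i * y ≈ 0#)
        (λ i → ↑-elim t (λ l → l Fin.< i ↑ˡ 2 → ∀ y →
            coeff (i ↑ˡ 2) * ((X ρ (i ↑ˡ 2) - X ρ l) * y) ≈ 0# → coeff (i ↑ˡ 2) * y ≈ 0#)
          (λ l l<i y eq → ζ-difference-regular
              (≡.subst₂ _<_ (Finₚ.toℕ-↑ˡ l 2) (Finₚ.toℕ-↑ˡ i 2) l<i)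
            (Finₚ.toℕ<n i) (coeff (i ↑ˡ 2) * y) (trans
              (solve 3 (λ d c y → d :* (c :* y) := c :* (d :* y)) refl
                (ζ ^ toℕ i - ζ ^ toℕ l) (coeff (i ↑ˡ 2)) y)
              (trans (*-congˡ (*-congʳ (reflexive (≡.sym
                (≡.cong₂ _-_ (points-ζ t ζ z w i) (points-ζ t ζ z w l)))))) eq)))
          (λ l l<i → contradiction (ℕₚ.≤-<-trans (ℕₚ.m≤m+n t (toℕ l))
              (≡.subst₂ _<_ (Finₚ.toℕ-↑ʳ t l) (Finₚ.toℕ-↑ˡ i 2) l<i))
            (ℕₚ.<-asym (Finₚ.toℕ<n i))) l)
        (λ i _ y _ → trans (*-congʳ (reflexive (coeffʳ i))) (zeroˡ y)) i
      relation : ∀ j → (∑ λ i → coeff i * X ρ i ^ e j) ≈ 0#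
      relation j = begin
        (∑ λ i → coeff i * X ρ i ^ e j)
          ≈⟨ ∑-++ t (λ i → coeff i * X ρ i ^ e j) ⟩
        (∑ λ i → coeff (i ↑ˡ 2) * X ρ (i ↑ˡ 2) ^ e j) ⊹
          (∑ λ i → coeff (t ↑ʳ i) * X ρ (t ↑ʳ i) ^ e j)
          ≈⟨ +-cong (sum-cong-≋ {t} λ i → reflexive
               (≡.cong₂ (λ c x → c * x ^ e j) (coeffˡ i) (points-ζ t ζ z w i)))
               (sum-zero {2} λ i → trans (*-congʳ (reflexive (coeffʳ i))) (zeroˡ (X ρ (t ↑ʳ i) ^ e j))) ⟩
        residueSum (toℕ r) (e j) ⊹ 0#
          ≈⟨ trans (+-identityʳ _) (residueSum-≢ (e j) (Finₚ.toℕ<n r) (e≢r j)) ⟩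
        0# ∎

-- Linear combinations and clearing of entries within a row space.

module SpanClosure {c ℓ} (R : CommutativeRing c ℓ) where

  open CommutativeRing R hiding (zero) renaming (_+_ to _⊹_)
  open Schur R
  open RowSpace R
  open RawMonoidDefs +-rawMonoid using () renaming (sum to ∑)
  open RingProps ring using (-‿distribˡ-*)

  span-∑ : ∀ {n m} {M : Matrix n} (c : Vector Carrier m) {v : Fin m → Vector Carrier n} →
           (∀ i → Span M (v i)) → Span M (λ j → ∑ λ i → c i * v i j)
  span-∑ {m = zero}  c v∈M = zero λ _ → refl
  span-∑ {m = suc m} c v∈M =
    combine (c zero) (span-∑ (c ∘ suc) (v∈M ∘ suc)) (v∈M zero) λ _ → +-comm _ _

  -- Elimination without division: `v` is first multiplied by the pivot `e i`, so the other entries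
  -- survive up to the regular factor `κ`.
  span-clear : ∀ {n} {M : Matrix n} {i} {v} → SpansUnit M i → Span M v →
    ∃[ w ] (Span M w × w i ≈ 0# × ∃[ κ ] (Regular κ × (∀ j → j ≢ i → w j ≈ κ * v j)))
  span-clear {M = M} {i} {v} (e , e∈M , eᵢ-reg , e≈0) v∈M =
    (λ j → e i * v j ⊹ - v i * e j)
    -- `combine` scales only its second vector, so a multiple of `v` is formed by adding it to the
    -- zero vector.
    , combine (- v i) (combine {u = λ _ → 0#} (e i) (zero λ _ → refl) v∈M (λ j → sym (+-identityˡ _)))
        e∈M (λ j → refl)
    , trans (+-congˡ (trans (sym (-‿distribˡ-* (v i) (e i))) (-‿cong (*-comm (v i) (e i)))))
        (-‿inverseʳ _)
    , e i , eᵢ-reg , λ j j≢i → trans (+-congˡ (trans (*-congˡ (e≈0 j j≢i)) (zeroʳ _))) (+-identityʳ _)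

-- Representatives of the residue classes.

module Representatives (t : ℕ) .{{_ : NonZero t}} {N} (β : Vector ℕ N)
  (rep : Fin t → Fin N) (rep-residue : ∀ r → β (rep r) % t ≡ toℕ r) where

  residue : Fin N → Fin t
  residue j = fromℕ< (m%n<n (β j) t)

  residue-% : ∀ j → β j % t ≡ toℕ (residue j)
  residue-% j = ≡.sym (Finₚ.toℕ-fromℕ< (m%n<n (β j) t))

  representative : Fin N → Fin N
  representative j = rep (residue j)

  representative-rep : ∀ r → representative (rep r) ≡ rep r
  representative-rep r =
    ≡.cong rep (Finₚ.toℕ-injective (≡.trans (≡.sym (residue-% (rep r))) (rep-residue r)))

-- Nonvanishing of the alternant when every class is represented.

module Nonvanishing {c ℓ} (R : CommutativeRing c ℓ) where

  open CommutativeRing R hiding (zero) renaming (_+_ to _⊹_)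
  open Schur R
  open RowSpace R
  open SpanClosure R
  open Powers R
  open RootOfUnity R
  open RawMonoidDefs +-rawMonoid using () renaming (sum to ∑)
  open ExpProps semiring using (_^_; ^-homo-*; ^-congˡ)
  open CommExpProps commutativeSemiring using (^-distrib-*)
  open AbelianGroupProps +-abelianGroup using (⁻¹-anti-homo‿-)
  open RingProps ring using (-‿distribˡ-*; -‿distribʳ-*; x[y-z]≈xy-xz)
  open Solver commutativeSemiring using (solve; _:+_; _:*_; _:=_)
  open SetoidReasoning setoid

  module Inverse {z w : Carrier} (zw≈1 : z * w ≈ 1#) where

    w-regular : Regular w
    w-regular = regular-factor (regular-resp (trans (sym zw≈1) (*-comm z w)) regular-1)

    cancel-powers : ∀ a y → z ^ a * (w ^ a * y) ≈ y
    cancel-powers a y = begin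
      z ^ a * (w ^ a * y)
        ≈⟨ *-assoc _ _ _ ⟨
      z ^ a * w ^ a * y
        ≈⟨ *-congʳ (^-distrib-* z w a) ⟨
      (z * w) ^ a * y
        ≈⟨ *-congʳ (trans (^-congˡ a zw≈1) (1^ a)) ⟩
      1# * y
        ≈⟨ *-identityˡ y ⟩
      y ∎

    inverse-difference : ∀ a b → w ^ a - w ^ b ≈ w ^ (a + b) * (z ^ b - z ^ a)
    inverse-difference a b = sym (begin
      w ^ (a + b) * (z ^ b - z ^ a)
        ≈⟨ x[y-z]≈xy-xz _ _ _ ⟩
      w ^ (a + b) * z ^ b - w ^ (a + b) * z ^ a
        ≈⟨ +-cong
             (trans (*-congʳ (^-homo-* w a b)) (trans
               (solve 3 (λ p q r → p :* q :* r := r :* (q :* p)) refl (w ^ a) (w ^ b) (z ^ b))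
               (cancel-powers b (w ^ a))))
             (-‿cong (trans (*-congʳ (^-homo-* w a b)) (trans
               (solve 3 (λ p q r → p :* q :* r := r :* (p :* q)) refl (w ^ a) (w ^ b) (z ^ a))
               (cancel-powers a (w ^ b))))) ⟩
      w ^ a - w ^ b ∎)

    -- Placing the sign on the scalar exhibits the reduced row of `w` as an entrywise multiple of
    -- the reduced row of `z`.
    inverse-difference⁻ : ∀ a b → w ^ a - w ^ b ≈ - w ^ (a + b) * (z ^ a - z ^ b)
    inverse-difference⁻ a b = begin
      w ^ a - w ^ b
        ≈⟨ inverse-difference a b ⟩
      w ^ (a + b) * (z ^ b - z ^ a)
        ≈⟨ *-congˡ (⁻¹-anti-homo‿- (z ^ a) (z ^ b)) ⟨
      w ^ (a + b) * - (z ^ a - z ^ b)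
        ≈⟨ -‿distribʳ-* _ _ ⟨
      - (w ^ (a + b) * (z ^ a - z ^ b))
        ≈⟨ -‿distribˡ-* _ _ ⟩
      - w ^ (a + b) * (z ^ a - z ^ b) ∎

  module _ (t : ℕ) .{{_ : NonZero t}} {ζ : Carrier} (ζ^t≈1 : ζ ^ t ≈ 1#)
           (ζ^k-1-regular : ∀ k → 0 < k → k < t → Regular (ζ ^ k - 1#))
           (t-regular : Regular (∑ {t} λ _ → 1#))
           {z w : Carrier} (zw≈1 : z * w ≈ 1#)
           (z-difference-regular : ∀ {a b} → a ≢ b → Regular (z ^ a - z ^ b))
           (β : Vector ℕ (t + 2)) (rep : Fin t → Fin (t + 2))
           (rep-residue : ∀ r → β (rep r) % t ≡ toℕ r) where

    open Inverse zw≈1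

    private
      ρ : Vec Carrier (t + 2)
      ρ = points t ζ z w
      M : Matrix (t + 2)
      M i j = Vec.lookup ρ i ^ β j
      T : Carrier
      T = ∑ {t} λ _ → 1#
      L : Fin t → Vector Carrier (t + 2)
      L r j = residueSum t ζ^t≈1 ζ^k-1-regular (toℕ r) (β j)

    open Representatives t β rep rep-residue

    w-difference-regular : ∀ {a b} → a ≢ b → Regular (w ^ a - w ^ b)
    w-difference-regular {a} {b} a≢b = regular-resp (sym (inverse-difference a b))
      (regular-* (regular-^ (a + b) w-regular) (z-difference-regular (a≢b ∘ ≡.sym)))

    L-same : ∀ r j → β j % t ≡ toℕ r → L r j ≈ T
    L-same r j = residueSum-≡ t ζ^t≈1 ζ^k-1-regular (β j) (Finₚ.toℕ<n r)

    L-other : ∀ r j → β j % t ≢ toℕ r → L r j ≈ 0#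
    L-other r j = residueSum-≢ t ζ^t≈1 ζ^k-1-regular (β j) (Finₚ.toℕ<n r)

    power-span : ∀ i {x} → Vec.lookup ρ i ≡ x → Span M (λ j → x ^ β j)
    power-span i ≡.refl = row i λ _ → refl

    L-span : ∀ r → Span M (L r)
    L-span r = span-∑ (λ i → (ζ ^ toℕ i) ^ (t ∸ toℕ r)) λ i →
      power-span (i ↑ˡ 2) (points-ζ t ζ z w i)

    -- The row of x, cleared at the representatives by means of the functionals L r.
    reduced : Carrier → Vector Carrier (t + 2)
    reduced x j = T * (x ^ β j - x ^ β (representative j))

    -- In column `j` only the functional of the class of `j` is nonzero, with value `T`. Multiplying
    -- the row of `x` by `T` replaces a division by t.
    reduced-span : ∀ {x} → Span M (λ j → x ^ β j) → Span M (reduced x)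
    reduced-span {x} x∈M = combine T (span-∑ (λ r → - x ^ β (rep r)) L-span) x∈M λ j → begin
      T * (x ^ β j - x ^ β (representative j))
        ≈⟨ solve 3 (λ T p q → T :* (p :+ q) := q :* T :+ T :* p) refl
             T (x ^ β j) (- x ^ β (representative j)) ⟩
      - x ^ β (representative j) * T ⊹ T * x ^ β j
        ≈⟨ +-congʳ (*-congˡ (L-same (residue j) j (residue-% j))) ⟨
      - x ^ β (representative j) * L (residue j) j ⊹ T * x ^ β j
        ≈⟨ +-congʳ (∑-single (residue j) (λ r → - x ^ β (rep r) * L r j) λ r r≢ → trans
             (*-congˡ (L-other r j λ eq → r≢ (Finₚ.toℕ-injective (≡.trans (≡.sym eq) (residue-% j)))))
             (zeroʳ _)) ⟨
      (∑ λ r → - x ^ β (rep r) * L r j) ⊹ T * x ^ β j ∎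

    Q : Fin (t + 2) → Carrier
    Q j = w ^ (β j + β (representative j))

    -- Since reduced w = − Q * reduced z entrywise, this lies in the row space.
    eliminate : Fin (t + 2) → Vector Carrier (t + 2)
    eliminate v j = (Q v - Q j) * reduced z j

    eliminate-span : ∀ v → Span M (eliminate v)
    eliminate-span v = combine (Q v)
      (reduced-span (power-span (t ↑ʳ suc zero) (points-w t ζ z w)))
      (reduced-span (power-span (t ↑ʳ zero) (points-z t ζ z w))) λ j → begin
        (Q v - Q j) * (T * d j)
          ≈⟨ solve 4 (λ p q T d → (p :+ q) :* (T :* d) := T :* (q :* d) :+ p :* (T :* d)) refl
               (Q v) (- Q j) T (d j) ⟩
        T * (- Q j * d j) ⊹ Q v * (T * d j)
          ≈⟨ +-congʳ (*-congˡ (inverse-difference⁻ (β j) (β (representative j)))) ⟨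
        reduced w j ⊹ Q v * reduced z j ∎
      where
      d : Vector Carrier (t + 2)
      d j = z ^ β j - z ^ β (representative j)

    -- The scalar `Q v - Q j` vanishes at `v` and the reduced row vanishes at the representatives,
    -- which leaves `u`. There the scalar is regular because the two sums differ, and the reduced
    -- entry because `u` is not its own representative.
    eliminate-unit : ∀ {u v} → (∀ r → rep r ≢ u) → (∀ j → j ≡ u ⊎ j ≡ v ⊎ (∃[ r ] rep r ≡ j)) →
      (∀ {i j} → β i ≡ β j → i ≡ j) →
      β u + β (representative u) ≢ β v + β (representative v) → SpansUnit M u
    eliminate-unit {u} {v} u∉rep exhaustive β-injective sums-distinct =
      eliminate v , eliminate-span v
      , regular-* (w-difference-regular (sums-distinct ∘ ≡.sym)) (regular-* t-regular
          (z-difference-regular λ eq → u∉rep (residue u) (≡.sym (β-injective eq))))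
      , λ j j≢u → vanish j j≢u (exhaustive j)
      where
      vanish : ∀ j → j ≢ u → _ → eliminate v j ≈ 0#
      vanish j j≢u (inj₁ j≡u) = contradiction j≡u j≢u
      vanish j j≢u (inj₂ (inj₁ ≡.refl)) = trans (*-congʳ (-‿inverseʳ (Q v))) (zeroˡ _)
      vanish j j≢u (inj₂ (inj₂ (r , ≡.refl))) = trans (*-congˡ (trans (*-congˡ (trans
        (+-congˡ (-‿cong (reflexive (≡.cong (λ i → z ^ β i) (representative-rep r)))))
        (-‿inverseʳ _))) (zeroʳ T))) (zeroʳ _)

    module _ {u v : Fin (t + 2)} (u∉rep : ∀ r → rep r ≢ u) (v∉rep : ∀ r → rep r ≢ v)
             (exhaustive : ∀ j → j ≡ u ⊎ j ≡ v ⊎ (∃[ r ] rep r ≡ j)) (u≢v : u ≢ v)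
             (β-injective : ∀ {i j} → β i ≡ β j → i ≡ j)
             (sums-distinct : β u + β (representative u) ≢ β v + β (representative v)) where

      spansUnit-u : SpansUnit M u
      spansUnit-u = eliminate-unit u∉rep exhaustive β-injective sums-distinct

      spansUnit-v : SpansUnit M v
      spansUnit-v = eliminate-unit v∉rep (swap ∘ exhaustive) β-injective (sums-distinct ∘ ≡.sym)
        where
        swap : ∀ {j} → j ≡ u ⊎ j ≡ v ⊎ (∃[ r ] rep r ≡ j) → j ≡ v ⊎ j ≡ u ⊎ (∃[ r ] rep r ≡ j)
        swap (inj₁ j≡u)        = inj₂ (inj₁ j≡u)
        swap (inj₂ (inj₁ j≡v)) = inj₁ j≡v
        swap (inj₂ (inj₂ j∈rep)) = inj₂ (inj₂ j∈rep)

      -- Among the representatives `L r` is supported on `rep r` alone; its possible entries at `u`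
      -- and `v` are cleared with the two unit vectors found above.
      spansUnit-rep : ∀ r → SpansUnit M (rep r)
      spansUnit-rep r =
        let L′ , L′∈M , L′u≈0 , κ , κ-reg , L′≈ = span-clear spansUnit-u (L-span r)
            L″ , L″∈M , L″v≈0 , κ′ , κ′-reg , L″≈ = span-clear spansUnit-v L′∈M
            L″≈L : ∀ j → j ≢ u → j ≢ v → L″ j ≈ κ′ * (κ * L r j)
            L″≈L = λ j j≢u j≢v → trans (L″≈ j j≢v) (*-congˡ (L′≈ j j≢u))
            vanish : ∀ j → j ≢ rep r → j ≡ u ⊎ j ≡ v ⊎ (∃[ s ] rep s ≡ j) → L″ j ≈ 0#
            vanish = λ where
              -- Clearing at `v` merely rescales the entry at `u`, which is already 0.
              j j≢rep (inj₁ ≡.refl) → trans (L″≈ j u≢v) (trans (*-congˡ L′u≈0) (zeroʳ κ′))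
              j j≢rep (inj₂ (inj₁ ≡.refl)) → L″v≈0
              j j≢rep (inj₂ (inj₂ (s , ≡.refl))) → trans (L″≈L j (u∉rep s) (v∉rep s))
                (trans (*-congˡ (trans (*-congˡ (L-other r j λ eq → j≢rep (≡.cong rep
                  (Finₚ.toℕ-injective (≡.trans (≡.sym (rep-residue s)) eq))))) (zeroʳ κ))) (zeroʳ κ′))
        in L″ , L″∈M
           , regular-resp (sym (trans (L″≈L (rep r) (u∉rep r) (v∉rep r))
               (*-congˡ (*-congˡ (L-same r (rep r) (rep-residue r))))))
               (regular-* κ′-reg (regular-* κ-reg t-regular))
           , λ j j≢rep → vanish j j≢rep (exhaustive j)

      alternant≉0 : ¬ 1# ≈ 0# → ¬ alternant β ρ ≈ 0#
      alternant≉0 1≉0 = det≉0 M 1≉0 λ j → unit (exhaustive j)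
        where
        unit : ∀ {j} → j ≡ u ⊎ j ≡ v ⊎ (∃[ r ] rep r ≡ j) → SpansUnit M j
        unit (inj₁ ≡.refl)              = spansUnit-u
        unit (inj₂ (inj₁ ≡.refl))       = spansUnit-v
        unit (inj₂ (inj₂ (r , ≡.refl))) = spansUnit-rep r

-- Arithmetic of sums of two congruent numbers.

residue-pair-sum : ∀ t .{{_ : NonZero t}} {r} a b → a % t ≡ r → b % t ≡ r →
                   a + b ≡ r + r + (a / t + b / t) ℕ.* t
residue-pair-sum t a b ≡.refl b%t≡r = begin
  a + b
    ≡⟨ ≡.cong₂ _+_ (m≡m%n+[m/n]*n a t) (m≡m%n+[m/n]*n b t) ⟩
  (a % t + a / t ℕ.* t) + (b % t + b / t ℕ.* t)
    ≡⟨ ≡.cong (λ r → (a % t + a / t ℕ.* t) + (r + b / t ℕ.* t)) b%t≡r ⟩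
  (a % t + a / t ℕ.* t) + (a % t + b / t ℕ.* t)
    ≡⟨ solve 4 (λ r p q t → (r :+ p :* t) :+ (r :+ q :* t) := r :+ r :+ (p :+ q) :* t) ≡.refl
         (a % t) (a / t) (b / t) t ⟩
  a % t + a % t + (a / t + b / t) ℕ.* t ∎
  where
  open ≡.≡-Reasoning
  open ℕSolver.+-*-Solver

-- (m - m′) t equals 2 (r′ - r), which lies strictly between 0 and 2t, so m - m′ is 1. This serves
-- both the criterion for `d₃` and the distinctness of u + û and v + v̂.
residue-gap : ∀ {t r r′} m m′ → r < r′ → r′ < t → r + r + m ℕ.* t ≡ r′ + r′ + m′ ℕ.* t →
              m ≡ suc m′ × t ≡ (r′ ∸ r) ℕ.* 2
residue-gap {t} {r} {r′} m m′ r<r′ r′<t eq = m≡1+m′ , ℕₚ.+-cancelʳ-≡ (m′ ℕ.* t) t (δ ℕ.* 2) (begin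
  t + m′ ℕ.* t
    ≡⟨ ≡.cong (ℕ._* t) m≡1+m′ ⟨
  m ℕ.* t
    ≡⟨ mt≡ ⟩
  δ ℕ.* 2 + m′ ℕ.* t ∎)
  where
  open ≡.≡-Reasoning
  open ℕSolver.+-*-Solver
  δ : ℕ
  δ = r′ ∸ r
  δ>0 : 0 < δ
  δ>0 = ℕₚ.m<n⇒0<n∸m r<r′
  mt≡ : m ℕ.* t ≡ δ ℕ.* 2 + m′ ℕ.* t
  mt≡ = ℕₚ.+-cancelˡ-≡ (r + r) _ _ (begin
    r + r + m ℕ.* t
      ≡⟨ eq ⟩
    r′ + r′ + m′ ℕ.* t
      ≡⟨ ≡.cong (λ r′ → r′ + r′ + m′ ℕ.* t) (ℕₚ.m+[n∸m]≡n (ℕₚ.<⇒≤ r<r′)) ⟨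
    (r + δ) + (r + δ) + m′ ℕ.* t
      ≡⟨ solve 3 (λ r δ k → (r :+ δ) :+ (r :+ δ) :+ k := r :+ r :+ (δ :* con 2 :+ k)) ≡.refl
           r δ (m′ ℕ.* t) ⟩
    r + r + (δ ℕ.* 2 + m′ ℕ.* t) ∎)
  m′<m : m′ < m
  m′<m = ℕₚ.*-cancelʳ-< t m′ m (≡.subst (m′ ℕ.* t <_) (≡.sym mt≡)
    (ℕₚ.m<n+m (m′ ℕ.* t) (ℕₚ.<-≤-trans δ>0 (ℕₚ.m≤m*n δ 2))))
  m<2+m′ : m < 2 + m′
  m<2+m′ = ℕₚ.*-cancelʳ-< t m (2 + m′) (≡.subst₂ _<_ (≡.sym mt≡)
    (solve 2 (λ t m′ → t :* con 2 :+ m′ :* t := t :+ (t :+ m′ :* t)) ≡.refl t m′)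
    (ℕₚ.+-monoˡ-< (m′ ℕ.* t) (ℕₚ.*-monoˡ-< 2 (ℕₚ.≤-<-trans (ℕₚ.m∸n≤m r′ r) r′<t))))
  m≡1+m′ : m ≡ suc m′
  m≡1+m′ = ℕₚ.≤-antisym (ℕₚ.≤-pred m<2+m′) m′<m

-- Beta sets, their residue classes and quotients.

module _ {N} (lam : Partition N) where

  beta-decreasing : ∀ {i j} → i Fin.< j → beta lam i > beta lam j
  beta-decreasing {i} {j} i<j = ℕₚ.+-mono-≤-< (decreasing lam (ℕₚ.<⇒≤ i<j))
    (ℕₚ.∸-monoʳ-< (s≤s i<j) (Finₚ.toℕ<n j))

  beta-injective : ∀ {i j} → beta lam i ≡ beta lam j → i ≡ j
  beta-injective {i} {j} eq with Finₚ.<-cmp i j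
  ... | tri< i<j _ _ = contradiction (≡.sym eq) (ℕₚ.<⇒≢ (beta-decreasing i<j))
  ... | tri≈ _ i≡j _ = i≡j
  ... | tri> _ _ j<i = contradiction eq (ℕₚ.<⇒≢ (beta-decreasing j<i))

  module _ (t : ℕ) .{{_ : NonZero t}} where

    class-decreasing : ∀ r → AllPairs _>_ (class t lam r)
    class-decreasing r =
      AllPairsₚ.filter⁺ (λ b → b % t ℕₚ.≟ r) (AllPairsₚ.tabulate⁺-< beta-decreasing)

    class-residue : ∀ r → All (λ b → b % t ≡ r) (class t lam r)
    class-residue r = Allₚ.all-filter (λ b → b % t ℕₚ.≟ r) (Vector.toList (beta lam))

    class≡[]⇒≢ : ∀ {r} → class t lam r ≡ [] → ∀ j → beta lam j % t ≢ r
    class≡[]⇒≢ {r} eq j β≡r with () ← ≡.subst (beta lam j ∈_) eq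
      (Membershipₚ.∈-filter⁺ (λ b → b % t ℕₚ.≟ r) (Membershipₚ.∈-tabulate⁺ j) β≡r)

    ≢⇒class≡[] : ∀ {r} → (∀ j → beta lam j % t ≢ r) → class t lam r ≡ []
    ≢⇒class≡[] {r} β≢r = Listₚ.filter-none (λ b → b % t ℕₚ.≟ r) (Allₚ.tabulate⁺ β≢r)

    module _ {r a₁ a₂} (class≡ : class t lam r ≡ a₁ ∷ a₂ ∷ []) where

      class-pair-residues : a₁ % t ≡ r × a₂ % t ≡ r
      class-pair-residues with p ∷ q ∷ [] ← ≡.subst (All _) class≡ (class-residue r) = p , q

      class-pair-> : a₁ > a₂
      class-pair-> with (p ∷ []) ∷ _ ← ≡.subst (AllPairs _>_) class≡ (class-decreasing r) = p

      class-pair-sum : a₁ + a₂ ≡ r + r + (a₁ / t + a₂ / t) ℕ.* t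
      class-pair-sum =
        residue-pair-sum t a₁ a₂ (proj₁ class-pair-residues) (proj₂ class-pair-residues)

      -- Removing the staircase from two elements lowers the first by 1 and keeps the second, so the
      -- size falls short of the sum by exactly 1.
      quotient-pair-sum : suc (sum (quotient t lam r)) ≡ a₁ / t + a₂ / t
      quotient-pair-sum = ≡.trans
        (≡.cong (λ as → suc (sum (removeStaircase (List.map (_/ t) as)))) class≡)
        (≡.trans (≡.cong (λ k → suc (a₁ / t ∸ 1 + k)) (ℕₚ.+-identityʳ (a₂ / t)))
          (≡.cong (_+ a₂ / t) (ℕₚ.m+[n∸m]≡n a₁/t>0)))
        where
        a₁/t>0 : 0 < a₁ / t
        -- The subtraction is not truncated: a zero quotient would give a₁ = r ≤ a₂.
        a₁/t>0 = ℕₚ.n≢0⇒n>0 λ a₁/t≡0 → ℕₚ.<⇒≱ class-pair-> (begin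
          a₁
            ≡⟨ m≡m%n+[m/n]*n a₁ t ⟩
          a₁ % t + a₁ / t ℕ.* t
            ≡⟨ ≡.cong₂ (λ r q → r + q ℕ.* t) (proj₁ class-pair-residues) a₁/t≡0 ⟩
          r + 0
            ≤⟨ ℕₚ.+-monoʳ-≤ r z≤n ⟩
          r + a₂ / t ℕ.* t
            ≡⟨ ≡.cong (_+ a₂ / t ℕ.* t) (proj₂ class-pair-residues) ⟨
          a₂ % t + a₂ / t ℕ.* t
            ≡⟨ m≡m%n+[m/n]*n a₂ t ⟨
          a₂ ∎)
          where open ℕₚ.≤-Reasoning

    -- Both sums have the form 2r + m t, where m is one more than the size of the quotient
    -- component. These shifts cancel, so mA = mB + 1 is the condition on the sizes.
    d₃≡0⇔ : ∀ {rA rB a₁ a₂ b₁ b₂} → rA < rB → rB < t →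
      class t lam rA ≡ a₁ ∷ a₂ ∷ [] → class t lam rB ≡ b₁ ∷ b₂ ∷ [] →
      (d₃ a₁ a₂ b₁ b₂ ≡ 0) ⇔
        (2 ∣ t × rB ∸ rA ≡ t / 2 × sum (quotient t lam rA) ≡ sum (quotient t lam rB) + 1)
    d₃≡0⇔ {rA} {rB} {a₁} {a₂} {b₁} {b₂} rA<rB rB<t classA classB = mk⇔ to from
      where
      open ≡.≡-Reasoning
      open ℕSolver.+-*-Solver
      mA mB qA qB δ : ℕ
      mA = a₁ / t + a₂ / t
      mB = b₁ / t + b₂ / t
      qA = sum (quotient t lam rA)
      qB = sum (quotient t lam rB)
      δ = rB ∸ rA
      to : d₃ a₁ a₂ b₁ b₂ ≡ 0 → 2 ∣ t × δ ≡ t / 2 × qA ≡ qB + 1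
      to d₃≡0 =
        let mA≡ , t≡ = residue-gap mA mB rA<rB rB<t (≡.trans (≡.sym (class-pair-sum classA))
              (≡.trans (ℕₚ.∣m-n∣≡0⇒m≡n d₃≡0) (class-pair-sum classB)))
        in divides δ t≡
         , ≡.trans (≡.sym (m*n/n≡m δ 2)) (≡.cong (_/ 2) (≡.sym t≡))
         , ℕₚ.suc-injective (begin
             suc qA       ≡⟨ quotient-pair-sum classA ⟩
             mA           ≡⟨ mA≡ ⟩
             suc mB       ≡⟨ ≡.cong suc (quotient-pair-sum classB) ⟨
             suc (suc qB) ≡⟨ ≡.cong suc (ℕₚ.+-comm 1 qB) ⟩
             suc (qB + 1) ∎)
      from : 2 ∣ t × δ ≡ t / 2 × qA ≡ qB + 1 → d₃ a₁ a₂ b₁ b₂ ≡ 0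
      from (divides h t≡ , δ≡ , qA≡) = ℕₚ.m≡n⇒∣m-n∣≡0 (begin
        a₁ + a₂
          ≡⟨ class-pair-sum classA ⟩
        rA + rA + mA ℕ.* t
          ≡⟨ ≡.cong (λ m → rA + rA + m ℕ.* t) mA≡ ⟩
        rA + rA + (t + mB ℕ.* t)
          ≡⟨ ≡.cong (λ s → rA + rA + (s + mB ℕ.* t)) t≡δ*2 ⟩
        rA + rA + (δ ℕ.* 2 + mB ℕ.* t)
          ≡⟨ solve 3 (λ r δ k → r :+ r :+ (δ :* con 2 :+ k) := (r :+ δ) :+ (r :+ δ) :+ k) ≡.refl
               rA δ (mB ℕ.* t) ⟩
        (rA + δ) + (rA + δ) + mB ℕ.* t
          ≡⟨ ≡.cong (λ r → r + r + mB ℕ.* t) (ℕₚ.m+[n∸m]≡n (ℕₚ.<⇒≤ rA<rB)) ⟩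
        rB + rB + mB ℕ.* t
          ≡⟨ class-pair-sum classB ⟨
        b₁ + b₂ ∎)
        where
        -- Divisibility makes the rounded quotient `t / 2` exact.
        t≡δ*2 : t ≡ δ ℕ.* 2
        t≡δ*2 = ≡.trans t≡ (≡.cong (ℕ._* 2) (≡.sym (≡.trans δ≡
          (≡.trans (≡.cong (_/ 2) t≡) (m*n/n≡m h 2)))))
        mA≡ : mA ≡ suc mB
        mA≡ = begin
          mA           ≡⟨ quotient-pair-sum classA ⟨
          suc qA       ≡⟨ ≡.cong suc qA≡ ⟩
          suc (qB + 1) ≡⟨ ≡.cong suc (ℕₚ.+-comm qB 1) ⟩
          suc (suc qB) ≡⟨ ≡.cong suc (quotient-pair-sum classB) ⟩
          suc mB ∎

-- Counting arguments for finite maps.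

-- If every value were hit, choosing preimages would inject `Fin n` into the smaller `Fin m`.
missed-value : ∀ {m n} → m < n → (f : Fin m → Fin n) → ∃[ u ] (∀ i → f i ≢ u)
missed-value m<n f with Finₚ.any? (λ u → Finₚ.all? λ i → ¬? (f i Finₚ.≟ u))
... | yes missed = missed
... | no ¬missed = contradiction (Finₚ.injective⇒≤ preimage-injective) (ℕₚ.<⇒≱ m<n)
  where
  hit : ∀ u → ∃[ i ] f i ≡ u
  hit u with Finₚ.any? (λ i → f i Finₚ.≟ u)
  ... | yes hit = hit
  ... | no ¬hit = contradiction (u , λ i eq → ¬hit (i , eq)) ¬missed
  preimage-injective : Injective _≡_ _≡_ (proj₁ ∘ hit)
  preimage-injective {u} {v} eq =
    ≡.trans (≡.sym (proj₂ (hit u))) (≡.trans (≡.cong f eq) (proj₂ (hit v)))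

∷-injective : ∀ {m n x} {f : Vector (Fin n) m} → (∀ i → f i ≢ x) → Injective _≡_ _≡_ f →
              Injective _≡_ _≡_ (x Vector.∷ f)
∷-injective x∉f f-inj {zero}  {zero}  eq = ≡.refl
∷-injective x∉f f-inj {zero}  {suc j} eq = contradiction (≡.sym eq) (x∉f j)
∷-injective x∉f f-inj {suc i} {zero}  eq = contradiction eq (x∉f i)
∷-injective x∉f f-inj {suc i} {suc j} eq = ≡.cong suc (f-inj eq)

-- Specialisation to a field of characteristic zero, evaluated at z = 2.

module Field {c ℓ₁ ℓ₂} (K : HeytingField c ℓ₁ ℓ₂) (charZero : CharacteristicZero K) where

  open HeytingField K hiding (zero) renaming (_+_ to _⊹_)

  ring : CommutativeRing c ℓ₁
  ring = HeytingCommutativeRing.commutativeRing heytingCommutativeRing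

  open CommutativeRing ring using (semiring; +-abelianGroup)
    renaming (ring to underlyingRing)
  open RowSpace ring
  open Powers ring
  open HeytingProps heytingCommutativeRing using (1#0; x-0≈x)
  open RawMonoidDefs (CommutativeRing.+-rawMonoid ring) using () renaming (_×_ to _·_)
  open MultProps semiring using (×1-homo-*)
  open ExpProps semiring using (_^_)
  open AbelianGroupProps +-abelianGroup using (⁻¹-anti-homo‿-; xyx⁻¹≈y)
  open RingProps underlyingRing using (-‿distribˡ-*; -‿involutive; -0#≈0#)

  1≉0 : ¬ 1# ≈ 0#
  1≉0 1≈0 = #-irrefl 1≈0 1#0

  #⇒regular : ∀ {x y} → x # y → Regular (x - y)
  #⇒regular x#y v dv≈0 =
    let d⁻¹ , d⁻¹d≈1 , _ = #⇒invertible x#y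
    in trans (sym (trans (*-congʳ d⁻¹d≈1) (*-identityˡ v)))
         (trans (*-assoc _ _ _) (trans (*-congˡ dv≈0) (zeroʳ d⁻¹)))

  #0⇒regular : ∀ {x} → x # 0# → Regular x
  #0⇒regular {x} x#0 = regular-resp (x-0≈x x) (#⇒regular x#0)

  regular-neg : ∀ {x} → Regular x → Regular (- x)
  regular-neg {x} x-reg y -xy≈0 = x-reg y (trans (sym (-‿involutive (x * y)))
    (trans (-‿cong (trans (-‿distribˡ-* x y) -xy≈0)) -0#≈0#))

  -- An explicit invertible choice of z whose distinct powers have regular differences in
  -- characteristic zero.
  two : Carrier
  two = 2 · 1#

  half : ∃[ w ] two * w ≈ 1#
  half = let w , _ , 2w≈1 = #⇒invertible (charZero 1)
         in w , trans (*-congʳ (sym (x-0≈x two))) 2w≈1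

  two-power : ∀ n → two ^ n ≈ (2 ℕ.^ n) · 1#
  two-power zero    = sym (+-identityʳ 1#)
  two-power (suc n) = trans (*-congˡ (two-power n)) (sym (×1-homo-* 2 (2 ℕ.^ n)))

  multiple-1-regular : ∀ {k} → 1 < k → Regular (k · 1# - 1#)
  multiple-1-regular {suc (suc k)} _ =
    -- Removing one summand from `suc (suc k)` copies of `1#` leaves `suc k`, the multiple that
    -- `charZero k` concerns.
    regular-resp (sym (xyx⁻¹≈y 1# _)) (#0⇒regular (charZero k))
  multiple-1-regular {suc zero} (s≤s ())

  two-difference-regular-< : ∀ {m n} → m < n → Regular (two ^ n - two ^ m)
  two-difference-regular-< {m} {n} m<n = regular-power-difference m n m<n
    (#0⇒regular (charZero 1)) (regular-resp (+-congʳ (sym (two-power (n ∸ m))))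
      (multiple-1-regular (ℕₚ.^-monoʳ-< 2 (s≤s (s≤s z≤n)) (ℕₚ.m<n⇒0<n∸m m<n))))

  two-difference-regular : ∀ {a b} → a ≢ b → Regular (two ^ a - two ^ b)
  two-difference-regular {a} {b} a≢b with ℕₚ.<-cmp a b
  ... | tri< a<b _ _ =
    regular-resp (⁻¹-anti-homo‿- (two ^ b) (two ^ a)) (regular-neg (two-difference-regular-< a<b))
  ... | tri≈ _ a≡b _ = contradiction a≡b a≢b
  ... | tri> _ _ b<a = two-difference-regular-< b<a

  module _ (t : ℕ) .{{_ : NonZero t}} (lam : Partition (t + 2))
           {ζ : Carrier} (ζ-primitive : PrimitiveRoot K t ζ) where

    open RootOfUnity ring
    open SumProps semiring using (sum-replicate)

    private
      β : Vector ℕ (t + 2)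
      β = beta lam

      ζ^k-1-regular : ∀ k → 0 < k → k < t → Regular (ζ ^ k - 1#)
      ζ^k-1-regular k 0<k k<t = #⇒regular (proj₂ ζ-primitive k 0<k k<t)

    -- `schur` is a product with factor `newton [] id β`, and this factor already vanishes at the
    -- point.
    empty⇒vanishes : ∃[ r ] (r < t × class t lam r ≡ []) → SchurVanishes K lam ζ
    empty⇒vanishes (r , r<t , class≡[]) z w _ = trans
      (*-congʳ (newton-missing-residue t (proj₁ ζ-primitive) ζ^k-1-regular z w β (fromℕ< r<t)
        λ j → ≡.subst (β j % t ≢_) (≡.sym (Finₚ.toℕ-fromℕ< r<t)) (class≡[]⇒≢ lam t class≡[] j)))
      (zeroˡ _)

    -- At z = 2 and w = 1/2 a vanishing Schur value would make the alternant vanish through the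
    -- bialternant identity.
    nonempty⇒¬vanishes : ¬ 2 ∣ t → (∀ (r : Fin t) → ∃[ j ] β j % t ≡ toℕ r) →
                         ¬ SchurVanishes K lam ζ
    nonempty⇒¬vanishes t-odd nonempty vanishes =
      alternant≉0 t (proj₁ ζ-primitive) ζ^k-1-regular t-regular (proj₂ half)
        two-difference-regular β rep rep-residue u∉rep v∉rep exhaustive u≢v
        (beta-injective lam) sums-distinct 1≉0 (begin
          alternant β ρ
            ≈⟨ bialternant (schur lam) ρ ⟨
          schurValue K lam ρ * alternant (staircase (t + 2)) ρ
            ≈⟨ *-congʳ (vanishes two (proj₁ half) (proj₂ half)) ⟩
          0# * alternant (staircase (t + 2)) ρ
            ≈⟨ zeroˡ _ ⟩
          0# ∎)
      where
      open Schur ring using (alternant; bialternant; schur)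
      open Nonvanishing ring using (alternant≉0)
      open SetoidReasoning setoid
      ρ : Vec Carrier (t + 2)
      ρ = points t ζ two (proj₁ half)
      rep : Fin t → Fin (t + 2)
      rep r = proj₁ (nonempty r)
      rep-residue : ∀ r → β (rep r) % t ≡ toℕ r
      rep-residue r = proj₂ (nonempty r)
      open Representatives t β rep rep-residue
      rep-injective : Injective _≡_ _≡_ rep
      rep-injective {r} {s} eq = Finₚ.toℕ-injective (≡.trans (≡.sym (rep-residue r))
        (≡.trans (≡.cong (λ i → β i % t) eq) (rep-residue s)))
      missed-u : ∃[ u ] (∀ r → rep r ≢ u)
      missed-u = missed-value (ℕₚ.m<m+n t (s≤s z≤n)) rep
      u : Fin (t + 2)
      u = proj₁ missed-u
      u∉rep : ∀ r → rep r ≢ u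
      u∉rep = proj₂ missed-u
      -- `u` and the representatives fill at most t + 1 of the t + 2 columns.
      missed-v : ∃[ v ] (∀ i → (u Vector.∷ rep) i ≢ v)
      missed-v = missed-value (ℕₚ.≤-reflexive (ℕₚ.+-comm 2 t)) (u Vector.∷ rep)
      v : Fin (t + 2)
      v = proj₁ missed-v
      v∉rep : ∀ r → rep r ≢ v
      v∉rep r = proj₂ missed-v (suc r)
      u≢v : u ≢ v
      u≢v = proj₂ missed-v zero
      exhaustive : ∀ j → j ≡ u ⊎ j ≡ v ⊎ (∃[ r ] rep r ≡ j)
      exhaustive j with j Finₚ.≟ u | j Finₚ.≟ v | Finₚ.any? (λ r → rep r Finₚ.≟ j)
      ... | yes j≡u | _       | _         = inj₁ j≡u
      ... | no _    | yes j≡v | _         = inj₂ (inj₁ j≡v)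
      ... | no _    | no _    | yes j∈rep = inj₂ (inj₂ j∈rep)
      -- A further column would give t + 3 distinct elements of `Fin (t + 2)`.
      ... | no j≢u  | no j≢v  | no j∉rep  = contradiction
        (Finₚ.injective⇒≤ (∷-injective j-new (∷-injective (proj₂ missed-v)
          (∷-injective u∉rep rep-injective))))
        (ℕₚ.<⇒≱ (s≤s (ℕₚ.≤-reflexive (ℕₚ.+-comm t 2))))
        where
        j-new : ∀ i → (v Vector.∷ u Vector.∷ rep) i ≢ j
        j-new zero          v≡j = j≢v (≡.sym v≡j)
        j-new (suc zero)    u≡j = j≢u (≡.sym u≡j)
        j-new (suc (suc r)) r≡j = j∉rep (r , r≡j)
      sum-representative : ∀ j → β j + β (representative j) ≡ toℕ (residue j) + toℕ (residue j) +
        (β j / t + β (representative j) / t) ℕ.* t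
      sum-representative j = residue-pair-sum t (β j) (β (representative j))
        (residue-% j) (rep-residue (residue j))
      sums-distinct-< : ∀ {i j} → toℕ (residue i) < toℕ (residue j) →
        β i + β (representative i) ≢ β j + β (representative j)
      -- Equal sums from different classes would make t twice the gap between the residues; oddness
      -- of t excludes this.
      sums-distinct-< {i} {j} ri<rj eq = t-odd (divides
        (toℕ (residue j) ∸ toℕ (residue i)) (proj₂ (residue-gap
        (β i / t + β (representative i) / t) (β j / t + β (representative j) / t)
        ri<rj (Finₚ.toℕ<n (residue j))
        (≡.trans (≡.sym (sum-representative i)) (≡.trans eq (sum-representative j))))))
      sums-distinct : β u + β (representative u) ≢ β v + β (representative v)
      sums-distinct with ℕₚ.<-cmp (toℕ (residue u)) (toℕ (residue v))
      ... | tri< ru<rv _ _ = sums-distinct-< ru<rv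
      ... | tri> _ _ rv<ru = sums-distinct-< rv<ru ∘ ≡.sym
      -- In a common class û = v̂, so equal sums would give equal exponents and hence u = v.
      ... | tri≈ _ ru≡rv _ = λ eq → u≢v (beta-injective lam (ℕₚ.+-cancelʳ-≡ _ _ _
        (≡.trans eq (≡.cong (λ r → β v + β (rep r)) (≡.sym (Finₚ.toℕ-injective ru≡rv))))))
      t-regular : Regular _
      t-regular = regular-resp (sym (sum-replicate t)) (t-multiple t)
        where
        t-multiple : ∀ t → .{{_ : NonZero t}} → Regular (t · 1#)
        t-multiple (suc n) = #0⇒regular (charZero n)

    -- Whether some class is empty is settled by a finite search, so the forward direction is
    -- constructive without deciding equality in the field.
    vanishes⇔empty : ¬ 2 ∣ t → SchurVanishes K lam ζ ⇔ (∃[ r ] (r < t × class t lam r ≡ []))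
    vanishes⇔empty t-odd = mk⇔ vanishes⇒empty empty⇒vanishes
      where
      vanishes⇒empty : SchurVanishes K lam ζ → ∃[ r ] (r < t × class t lam r ≡ [])
      vanishes⇒empty vanishes
        with Finₚ.any? (λ (r : Fin t) → Finₚ.all? λ j → ¬? (β j % t ℕₚ.≟ toℕ r))
      ... | yes (r , β≢r) = toℕ r , Finₚ.toℕ<n r , ≢⇒class≡[] lam t β≢r
      ... | no ¬missing = contradiction vanishes (nonempty⇒¬vanishes t-odd nonempty)
        where
        nonempty : ∀ (r : Fin t) → ∃[ j ] β j % t ≡ toℕ r
        nonempty r with Finₚ.any? (λ j → β j % t ℕₚ.≟ toℕ r)
        ... | yes hit = hit
        ... | no ¬hit = contradiction (r , λ j eq → ¬hit (j , eq)) ¬missing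

proposition3p5 : ∀ {c ℓ₁ ℓ₂} (t : ℕ) .{{_ : NonZero t}} → 2 ≤ t → (lam : Partition (t + 2)) →
    ((rA rB a₁ a₂ b₁ b₂ : ℕ) → rA < rB → rB < t →
    class t lam rA ≡ a₁ ∷ a₂ ∷ [] → class t lam rB ≡ b₁ ∷ b₂ ∷ [] →
    (∀ r → r < t → r ≢ rA → r ≢ rB → length (class t lam r) ≡ 1) →
    (d₃ a₁ a₂ b₁ b₂ ≡ 0) ⇔
    (2 ∣ t × rB ∸ rA ≡ t / 2 × sum (quotient t lam rA) ≡ sum (quotient t lam rB) + 1))
    ×
    (¬ (2 ∣ t) → (K : HeytingField c ℓ₁ ℓ₂) → CharacteristicZero K →
    (ζ : HeytingField.Carrier K) → PrimitiveRoot K t ζ →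
    SchurVanishes K lam ζ ⇔ (∃[ r ] (r < t × class t lam r ≡ [])))
proposition3p5 t _ lam =
    (λ _ _ _ _ _ _ rA<rB rB<t classA classB _ → d₃≡0⇔ lam t rA<rB rB<t classA classB)
  , λ t-odd K charZero ζ ζ-primitive → Field.vanishes⇔empty K charZero t lam ζ-primitive t-odd
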